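{- In the proportional setting, there does not exist an algorithm that, for every instance $(U,w)$ with $|U|=n$, takes $m$ samples for $m=o(\sqrt n/\varepsilon)$ and returns a $(1\pm\varepsilon)$-approximation of $W$ with probability $2/3$. This holds also when $n$ is known to the algorithm.
   Context: An instance $(U,w)$ consists of a finite set $U$ and a weight function $w:U\to[0,\infty)$; $W=\sum_{a\in U}w(a)$. The approximation parameter $\varepsilon$ satisfies $0<\varepsilon<1$. A value $\hat W$ is a $(1\pm\varepsilon)$-approximation of $W$ if $(1-\varepsilon)W\le\hat W\le(1+\varepsilon)W$. The asymptotic notation is for the limit $n\to\infty$, and makes sense also for constant $\varepsilon$. Proportional setting: the algorithm can interact with the items only by (1) proportionally sampling an item, which returns $(a,w(a))$ with probability $w(a)/W$; (2) given two items $a,a'$, checking whether $a=a'$.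
   Formalization: When ε depends on n, it is assumed bounded away from 1 by a constant (automatic for constant ε); otherwise the claim fails: for ε = 1 − 1/(3n), one sample a and output w(a) succeeds with probability at least 2/3. -}

module Defs where

open import Algebra.Core using (Op₁; Op₂)
open import Algebra.Bundles using (CommutativeRing)
open import Algebra.Structures using (IsCommutativeRing)
import Algebra.Definitions.RawMonoid as RawMonoidDefinitions
open import Data.Bool.Base using (Bool; true; false; if_then_else_)
open import Data.Fin.Base using (Fin)
import Data.Fin.Properties as Fin
open import Data.Nat.Base as ℕ using (ℕ; zero; suc)
open import Data.Product.Base using (_×_; ∃)
open import Data.Vec.Base using (Vec; []; _∷_; lookup)
open import Level using (Level; _⊔_) renaming (suc to lsuc)
open import Relation.Binary.Core using (Rel)
open import Relation.Binary.PropositionalEquality.Core using (_≡_; _≢_)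
import Relation.Binary.Construct.NonStrictToStrict as ToStrict
open import Relation.Binary.Structures using (IsDecTotalOrder)
open import Relation.Nullary.Decidable.Core using (does; _×-dec_)
open import Relation.Unary using (Pred; Decidable)

private
  variable
    c ℓ p : Level
    k n : ℕ

-- Archimedean ordered fields with a decidable order.  Classically, ℝ is one of
-- them; quantifying over all of them stands in for working over ℝ.

record ArchimedeanOrderedField c ℓ : Set (lsuc (c ⊔ ℓ)) where
  infix  8 _⁻¹ -_
  infixl 7 _*_ _/_
  infixl 6 _+_ _-_
  infix  4 _≤_
  field
    Carrier           : Set c
    _+_ _*_           : Op₂ Carrier
    -_                : Op₁ Carrier
    0# 1#             : Carrier
    isCommutativeRing : IsCommutativeRing _≡_ _+_ _*_ -_ 0# 1#
    0#≢1#             : 0# ≢ 1#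
    -- Total; the value of 0# ⁻¹ is unconstrained.
    _⁻¹               : Op₁ Carrier
    ⁻¹-inverseʳ       : ∀ x → x ≢ 0# → x * x ⁻¹ ≡ 1#
    _≤_               : Rel Carrier ℓ
    isDecTotalOrder   : IsDecTotalOrder _≡_ _≤_
    +-monoˡ-≤         : ∀ z {x y} → x ≤ y → x + z ≤ y + z
    *-nonNegative     : ∀ {x y} → 0# ≤ x → 0# ≤ y → 0# ≤ x * y

  commutativeRing : CommutativeRing c c
  commutativeRing = record { isCommutativeRing = isCommutativeRing }

  open RawMonoidDefinitions (CommutativeRing.+-rawMonoid commutativeRing) public
    using (sum) renaming (_×_ to _·_)
  open ToStrict _≡_ _≤_ public using (_<_)
  open IsDecTotalOrder isDecTotalOrder public using (_≤?_)

  _-_ : Op₂ Carrier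
  x - y = x + (- y)

  _/_ : Op₂ Carrier
  x / y = x * y ⁻¹

  fromℕ : ℕ → Carrier
  fromℕ j = j · 1#

  field
    archimedean       : ∀ x → ∃ λ j → x ≤ fromℕ j

module ProportionalSetting (F : ArchimedeanOrderedField c ℓ) where
  open ArchimedeanOrderedField F

  -- Proportional sampling is undefined when all weights vanish, hence W>0.

  record Instance (n : ℕ) : Set (c ⊔ ℓ) where
    field
      w   : Fin n → Carrier
      w≥0 : ∀ a → 0# ≤ w a

    W : Carrier
    W = sum w

    field
      W>0 : 0# < W

  -- Randomised adaptive programs that draw at most m further samples and hold
  -- k sampled items.  Items are opaque: a program refers to them only by the
  -- position at which they were drawn (zero is the most recent) and never sees
  -- an element of U.  After `sample` it is told the weight of the new item;
  -- `same? i j` tells it whether two held items are equal.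

  data Program : (m k : ℕ) → Set (c ⊔ ℓ) where
    return : ∀ {m k} → Carrier → Program m k
    sample : ∀ {m k} → (Carrier → Program m (suc k)) → Program (suc m) k
    same?  : ∀ {m k} → Fin k → Fin k → (Bool → Program m k) → Program m k
    flip   : ∀ {m k} (q : Carrier) → 0# ≤ q → q ≤ 1# →
             (Bool → Program m k) → Program m k

  Algorithm : ℕ → Set (c ⊔ ℓ)
  Algorithm m = Program m 0

  module _ (I : Instance n) {P : Pred Carrier p} (P? : Decidable P) where
    open Instance I

    PrFrom : ∀ {m} → Vec (Fin n) k → Program m k → Carrier
    PrFrom as (return x)     = if does (P? x) then 1# else 0#
    PrFrom as (sample κ)     = sum λ a → (w a / W) * PrFrom (a ∷ as) (κ (w a))
    PrFrom as (same? i j κ)  =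
      PrFrom as (κ (does (lookup as i Fin.≟ lookup as j)))
    PrFrom as (flip q _ _ κ) =
      q * PrFrom as (κ true) + (1# - q) * PrFrom as (κ false)

  -- The probability that the output of A on I satisfies P.

  Pr[_on_outputs_] : ∀ {m} → Algorithm m → Instance n →
                     {P : Pred Carrier p} → Decidable P → Carrier
  Pr[ A on I outputs P? ] = PrFrom I P? [] A

  IsApproximation : (ε W Ŵ : Carrier) → Set ℓ
  IsApproximation ε W Ŵ = (1# - ε) * W ≤ Ŵ × Ŵ ≤ (1# + ε) * W

  isApproximation? : ∀ ε W → Decidable (IsApproximation ε W)
  isApproximation? ε W Ŵ = ((1# - ε) * W ≤? Ŵ) ×-dec (Ŵ ≤? (1# + ε) * W)

  -- m(n) = o(√n / ε(n)) as n → ∞, for positive ε.  The field need not contain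
  -- √n, so  m(n) ≤ δ √n / ε(n)  is written  (m(n) ε(n))² ≤ δ² n.

  _=o[√n/_] : (ℕ → ℕ) → (ℕ → Carrier) → Set (c ⊔ ℓ)
  m =o[√n/ ε ] = ∀ δ → 0# < δ → ∃ λ N → ∀ n → N ℕ.≤ n →
    (fromℕ (m n) * ε n) * (fromℕ (m n) * ε n) ≤ (δ * δ) * fromℕ n

{-# OPTIONS --safe #-}
-- The hard instances consist of a heavy item of weight H = √k / ε together with
-- k′ ≤ k items of weight 1 and k - k′ of weight 0.  Let W be the total weight for
-- k′ = k, and W′ that for the largest k′ making the intervals (1 ± ε) W and
-- (1 ± ε) W′ disjoint.  Items being opaque, a run reveals only which draws are
-- heavy and how the light draws collide.  While few light items have been seen,
-- each draw multiplies the second moment of the likelihood ratio W′ : W by at most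
-- 1 + O(1/H), so m = o(H) draws keep it near 1, whereas many light items are seen
-- with probability o(1).  By Cauchy–Schwarz an output that is likely under W′ is
-- then under W of probability at least about (2/3)² > 1/3, which disjointness forbids.
module Submission where

open import Algebra.Bundles using (CommutativeRing)
import Algebra.Properties.AbelianGroup as AbelianGroupProperties
import Algebra.Properties.Ring as RingProperties
import Algebra.Properties.Semiring.Exp as SemiringExp
import Algebra.Properties.Semiring.Mult as SemiringMult
import Algebra.Properties.Semiring.Sum as SemiringSum
import Algebra.Solver.Ring as RingSolver
open import Algebra.Solver.Ring.AlmostCommutativeRing
  using (AlmostCommutativeRing; fromCommutativeRing; _-Raw-AlmostCommutative⟶_)
open import Data.Bool.Base using (true; false; if_then_else_)
open import Data.Empty using (⊥)
open import Data.Fin.Base as Fin using (Fin; zero; suc)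
import Data.Fin.Properties as Fin
open import Data.Integer.Base as ℤ using (ℤ; -[1+_])
import Data.Integer.Properties as ℤ
open import Data.Maybe.Base using (just; nothing)
open import Data.Nat.Base as ℕ using (ℕ; zero; suc; z≤n; s≤s)
import Data.Nat.Properties as ℕ
open import Data.Product.Base using (Σ-syntax; _×_; _,_; proj₁; proj₂; ∃)
open import Data.Sum.Base using (_⊎_; inj₁; inj₂)
open import Data.Vec.Base as Vec using (Vec; []; lookup) renaming (_∷_ to _∷ᵥ_)
open import Data.Vec.Functional using (_∷_)
import Data.Vec.Properties as Vec
open import Function.Definitions using (Injective)
open import Level using (_⊔_)
open import Relation.Binary.Definitions using (WeaklyDecidable)
open import Relation.Binary.PropositionalEquality
  using (_≡_; _≢_; refl; sym; trans; cong; cong₂; subst; subst₂; module ≡-Reasoning)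
open import Relation.Binary.Structures using (IsDecTotalOrder)
open import Relation.Nullary.Decidable.Core using (yes; no; does)
open import Relation.Nullary.Negation.Core using (¬_; contradiction)
open import Relation.Unary using (Pred; Decidable)
open import Defs

-- The scale H = √k / ε comes from balancing a single draw. Let V be the weight already seen and e =
-- W - W′, at most of order ε W. The second moment of the likelihood ratio of one draw exceeds 1 by
-- e² V / ((W - V) W′²). With V of order H and W - V of order at least k this is of order ε² H / k,
-- which is 1 / H for exactly this H.
--
-- What counts as few light items must fit both regimes of ε. If k exceeds H, then o(H) draws meet
-- only o(H) of them; if H exceeds k, a draw is light with probability about k / H, so only o(k) are
-- met. The threshold 1/θ is therefore of order min(H, k).
--
-- No distribution on transcripts is ever formed. Both instances are run through one tree of labels,
-- and Cauchy-Schwarz is applied node by node as an inequality between expected payoffs. Everything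
-- stays a finite sum in a field that need not contain square roots.

module FieldProperties {c ℓ} (F : ArchimedeanOrderedField c ℓ) where
  open ArchimedeanOrderedField F
  open CommutativeRing commutativeRing using (ring; semiring; +-abelianGroup)
  open CommutativeRing commutativeRing public using
    ( +-assoc; +-comm; +-identityˡ; +-identityʳ; -‿inverseʳ
    ; *-comm; *-identityˡ; *-identityʳ; zeroˡ; zeroʳ; distribˡ )
  open RingProperties ring using (-‿distribˡ-*; -‿distribʳ-*; -‿involutive; -0#≈0#)
  open AbelianGroupProperties +-abelianGroup using (⁻¹-∙-comm)
  open SemiringSum semiring public
    using (sum-cong-≗; ∑-distrib-+; ∑-comm; *-distribʳ-sum; sum-replicate-zero)
  open IsDecTotalOrder isDecTotalOrder public
    using () renaming (refl to ≤-refl; trans to ≤-trans; antisym to ≤-antisym;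
                       total to ≤-total; reflexive to ≤-reflexive)
  open ≡-Reasoning

  -- Integer coefficients for the ring solver

  fromℕ-+ : ∀ i j → fromℕ (i ℕ.+ j) ≡ fromℕ i + fromℕ j
  fromℕ-+ = SemiringMult.×-homo-+ semiring 1#

  fromℕ-* : ∀ i j → fromℕ (i ℕ.* j) ≡ fromℕ i * fromℕ j
  fromℕ-* = SemiringMult.×1-homo-* semiring

  private
    -- 1 is sent to 1# on the nose, so that the solver's unit is 1# and not 1# + 0#.
    numeral : ℕ → Carrier
    numeral 0               = 0#
    numeral 1               = 1#
    numeral n@(suc (suc _)) = fromℕ n

    numeral≡fromℕ : ∀ n → numeral n ≡ fromℕ n
    numeral≡fromℕ 0             = refl
    numeral≡fromℕ 1             = sym (+-identityʳ 1#)
    numeral≡fromℕ (suc (suc n)) = refl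

    fromℤ : ℤ → Carrier
    fromℤ (ℤ.+ n)    = numeral n
    fromℤ -[1+ n ] = - numeral (suc n)

    fromℤ-⊖ : ∀ i j → fromℤ (i ℤ.⊖ j) ≡ fromℕ i - fromℕ j
    fromℤ-⊖ i zero = trans (numeral≡fromℕ i)
      (sym (trans (cong (fromℕ i +_) -0#≈0#) (+-identityʳ _)))
    fromℤ-⊖ zero (suc j) = trans (cong -_ (numeral≡fromℕ (suc j))) (sym (+-identityˡ _))
    fromℤ-⊖ (suc i) (suc j) = begin
      fromℤ (suc i ℤ.⊖ suc j)                  ≡⟨ cong fromℤ (ℤ.[1+m]⊖[1+n]≡m⊖n i j) ⟩
      fromℤ (i ℤ.⊖ j)                          ≡⟨ fromℤ-⊖ i j ⟩
      fromℕ i - fromℕ j                        ≡⟨ sym (+-identityˡ _) ⟩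
      0# + (fromℕ i - fromℕ j)                 ≡⟨ cong (_+ (fromℕ i - fromℕ j)) (sym (-‿inverseʳ 1#)) ⟩
      (1# - 1#) + (fromℕ i - fromℕ j)          ≡⟨ +-assoc _ _ _ ⟩
      1# + (- 1# + (fromℕ i - fromℕ j))        ≡⟨ cong (1# +_) (sym (+-assoc _ _ _)) ⟩
      1# + ((- 1# + fromℕ i) - fromℕ j)        ≡⟨ cong (λ z → 1# + (z - fromℕ j)) (+-comm _ _) ⟩
      1# + ((fromℕ i - 1#) - fromℕ j)          ≡⟨ cong (1# +_) (+-assoc _ _ _) ⟩
      1# + (fromℕ i + (- 1# - fromℕ j))        ≡⟨ sym (+-assoc _ _ _) ⟩
      (1# + fromℕ i) + (- 1# - fromℕ j)        ≡⟨ cong (fromℕ (suc i) +_) (⁻¹-∙-comm _ _) ⟩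
      fromℕ (suc i) - fromℕ (suc j)            ∎

    fromℤ-+ : ∀ x y → fromℤ (x ℤ.+ y) ≡ fromℤ x + fromℤ y
    fromℤ-+ (ℤ.+ i) (ℤ.+ j) = trans (numeral≡fromℕ (i ℕ.+ j))
      (trans (fromℕ-+ i j) (sym (cong₂ _+_ (numeral≡fromℕ i) (numeral≡fromℕ j))))
    fromℤ-+ (ℤ.+ i) -[1+ j ] = trans (fromℤ-⊖ i (suc j))
      (sym (cong₂ (λ x y → x - y) (numeral≡fromℕ i) (numeral≡fromℕ (suc j))))
    fromℤ-+ -[1+ i ] (ℤ.+ j) = trans (fromℤ-⊖ j (suc i)) (trans (+-comm _ _)
      (sym (cong₂ (λ x y → - x + y) (numeral≡fromℕ (suc i)) (numeral≡fromℕ j))))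
    fromℤ-+ -[1+ i ] -[1+ j ] = begin
      - fromℕ (suc (suc (i ℕ.+ j)))       ≡⟨ cong (λ n → - fromℕ n) (sym (ℕ.+-suc (suc i) j)) ⟩
      - fromℕ (suc i ℕ.+ suc j)           ≡⟨ cong -_ (fromℕ-+ (suc i) (suc j)) ⟩
      - (fromℕ (suc i) + fromℕ (suc j))   ≡⟨ sym (⁻¹-∙-comm _ _) ⟩
      - fromℕ (suc i) - fromℕ (suc j)     ≡⟨ cong₂ (λ x y → - x - y)
                                               (sym (numeral≡fromℕ (suc i))) (sym (numeral≡fromℕ (suc j))) ⟩
      fromℤ -[1+ i ] + fromℤ -[1+ j ]     ∎

    fromℤ-neg : ∀ x → fromℤ (ℤ.- x) ≡ - fromℤ x
    fromℤ-neg (ℤ.+ zero)  = sym -0#≈0#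
    fromℤ-neg (ℤ.+ suc n) = refl
    fromℤ-neg -[1+ n ]  = sym (-‿involutive _)

    fromℤ-*-+ : ∀ i j → fromℤ ((ℤ.+ i) ℤ.* (ℤ.+ j)) ≡ fromℤ (ℤ.+ i) * fromℤ (ℤ.+ j)
    fromℤ-*-+ i j = begin
      fromℤ ((ℤ.+ i) ℤ.* (ℤ.+ j))   ≡⟨ cong fromℤ (sym (ℤ.pos-* i j)) ⟩
      numeral (i ℕ.* j)         ≡⟨ numeral≡fromℕ (i ℕ.* j) ⟩
      fromℕ (i ℕ.* j)           ≡⟨ fromℕ-* i j ⟩
      fromℕ i * fromℕ j         ≡⟨ sym (cong₂ _*_ (numeral≡fromℕ i) (numeral≡fromℕ j)) ⟩
      numeral i * numeral j     ∎

    fromℤ-*-neg : ∀ x j → fromℤ (x ℤ.* (ℤ.+ suc j)) ≡ fromℤ x * fromℤ (ℤ.+ suc j) →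
                  fromℤ (x ℤ.* -[1+ j ]) ≡ fromℤ x * fromℤ -[1+ j ]
    fromℤ-*-neg x j eq = begin
      fromℤ (x ℤ.* -[1+ j ])          ≡⟨ cong fromℤ (sym (ℤ.neg-distribʳ-* x (ℤ.+ suc j))) ⟩
      fromℤ (ℤ.- (x ℤ.* ℤ.+ suc j))     ≡⟨ fromℤ-neg (x ℤ.* ℤ.+ suc j) ⟩
      - fromℤ (x ℤ.* ℤ.+ suc j)         ≡⟨ cong -_ eq ⟩
      - (fromℤ x * fromℤ (ℤ.+ suc j))   ≡⟨ -‿distribʳ-* _ _ ⟩
      fromℤ x * fromℤ -[1+ j ]        ∎

    fromℤ-*-pos : ∀ x j → fromℤ (x ℤ.* (ℤ.+ j)) ≡ fromℤ x * fromℤ (ℤ.+ j)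
    fromℤ-*-pos (ℤ.+ i)    j = fromℤ-*-+ i j
    fromℤ-*-pos -[1+ i ] j = begin
      fromℤ (-[1+ i ] ℤ.* ℤ.+ j)             ≡⟨ cong fromℤ (sym (ℤ.neg-distribˡ-* (ℤ.+ suc i) (ℤ.+ j))) ⟩
      fromℤ (ℤ.- (ℤ.+ suc i ℤ.* ℤ.+ j))        ≡⟨ fromℤ-neg (ℤ.+ suc i ℤ.* ℤ.+ j) ⟩
      - fromℤ (ℤ.+ suc i ℤ.* ℤ.+ j)            ≡⟨ cong -_ (fromℤ-*-+ (suc i) j) ⟩
      - (fromℤ (ℤ.+ suc i) * fromℤ (ℤ.+ j))    ≡⟨ -‿distribˡ-* _ _ ⟩
      fromℤ -[1+ i ] * fromℤ (ℤ.+ j)         ∎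

    fromℤ-* : ∀ x y → fromℤ (x ℤ.* y) ≡ fromℤ x * fromℤ y
    fromℤ-* x (ℤ.+ j)    = fromℤ-*-pos x j
    fromℤ-* x -[1+ j ] = fromℤ-*-neg x j (fromℤ-*-pos x (suc j))

    almostCommutativeRing : AlmostCommutativeRing c c
    almostCommutativeRing = fromCommutativeRing commutativeRing

    fromℤ-morphism : ℤ.+-*-rawRing -Raw-AlmostCommutative⟶ almostCommutativeRing
    fromℤ-morphism = record
      { ⟦_⟧    = fromℤ
      ; +-homo = fromℤ-+
      ; *-homo = fromℤ-*
      ; -‿homo = fromℤ-neg
      ; 0-homo = refl
      ; 1-homo = refl
      }

    fromℤ-≟ : WeaklyDecidable (λ x y → fromℤ x ≡ fromℤ y)
    fromℤ-≟ x y with x ℤ.≟ y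
    ... | yes x≡y = just (cong fromℤ x≡y)
    ... | no _    = nothing

  module Solver = RingSolver ℤ.+-*-rawRing almostCommutativeRing fromℤ-morphism fromℤ-≟
  open Solver using (solve; _:=_; _:+_; _:*_; _:-_)

  -- Inequalities in an ordered field

  lit : ∀ {n} → ℕ → Solver.Polynomial n
  lit n = Solver.con (ℤ.+ n)

  -- An inequality is mostly derived from a certificate: an expression for the
  -- difference of its sides as a sum of products of nonnegative quantities.
  certificate : ∀ {x y e} → 0# ≤ e → y - x ≡ e → x ≤ y
  certificate {x} {y} {e} 0≤e eq = subst₂ _≤_ (+-identityˡ x)
    (trans (cong (_+ x) (sym eq)) (solve 2 (λ x y → (y :- x) :+ x := y) refl x y))
    (+-monoˡ-≤ x 0≤e)

  difference : ∀ {x y} → x ≤ y → 0# ≤ y - x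
  difference {x} {y} x≤y = subst (_≤ y - x) (-‿inverseʳ x) (+-monoˡ-≤ (- x) x≤y)

  infixl 6 _⊕_
  infixl 7 _⊗_

  -- With `_⊕_` and `_⊗_` a proof of nonnegativity copies the shape of its expression, so a
  -- certificate displays the sum of products it stands for.
  _⊕_ : ∀ {x y} → 0# ≤ x → 0# ≤ y → 0# ≤ x + y
  _⊕_ {x} {y} 0≤x 0≤y =
    ≤-trans 0≤y (subst (_≤ x + y) (+-identityˡ y) (+-monoˡ-≤ y 0≤x))

  _⊗_ : ∀ {x y} → 0# ≤ x → 0# ≤ y → 0# ≤ x * y
  _⊗_ = *-nonNegative

  +-mono : ∀ {x y x′ y′} → x ≤ y → x′ ≤ y′ → x + x′ ≤ y + y′
  +-mono {x} {y} {x′} {y′} p q = certificate (difference p ⊕ difference q)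
    (solve 4 (λ x y x′ y′ → (y :+ y′) :- (x :+ x′) := (y :- x) :+ (y′ :- x′)) refl x y x′ y′)

  *-monoˡ : ∀ {z x y} → 0# ≤ z → x ≤ y → z * x ≤ z * y
  *-monoˡ {z} {x} {y} 0≤z p = certificate (0≤z ⊗ difference p)
    (solve 3 (λ x y z → z :* y :- z :* x := z :* (y :- x)) refl x y z)

  square-nonneg : ∀ x → 0# ≤ x * x
  square-nonneg x with ≤-total 0# x
  ... | inj₁ 0≤x = 0≤x ⊗ 0≤x
  ... | inj₂ x≤0 = subst (0# ≤_) (solve 1 (λ x → (lit 0 :- x) :* (lit 0 :- x) := x :* x) refl x)
                         (difference x≤0 ⊗ difference x≤0)

  0≤1 : 0# ≤ 1#
  0≤1 = subst (0# ≤_) (*-identityˡ 1#) (square-nonneg 1#)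

  0≤fromℕ : ∀ n → 0# ≤ fromℕ n
  0≤fromℕ zero    = ≤-refl
  0≤fromℕ (suc n) = 0≤1 ⊕ 0≤fromℕ n

  fromℕ-mono : ∀ {i j} → i ℕ.≤ j → fromℕ i ≤ fromℕ j
  fromℕ-mono {j = j} z≤n = 0≤fromℕ j
  fromℕ-mono (s≤s i≤j)   = +-mono ≤-refl (fromℕ-mono i≤j)

  ≰⇒≥ : ∀ {x y} → ¬ x ≤ y → y ≤ x
  ≰⇒≥ {x} {y} x≰y with ≤-total x y
  ... | inj₁ x≤y = contradiction x≤y x≰y
  ... | inj₂ y≤x = y≤x

  ≰⇒> : ∀ {x y} → ¬ x ≤ y → y < x
  ≰⇒> x≰y = ≰⇒≥ x≰y , λ { refl → x≰y ≤-refl }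

  <⇒≱ : ∀ {x y} → x < y → ¬ y ≤ x
  <⇒≱ (x≤y , x≢y) y≤x = x≢y (≤-antisym x≤y y≤x)

  <-≤-trans : ∀ {x y z} → x < y → y ≤ z → x < z
  <-≤-trans x<y y≤z = ≤-trans (proj₁ x<y) y≤z , λ { refl → <⇒≱ x<y y≤z }

  0<1 : 0# < 1#
  0<1 = 0≤1 , 0#≢1#

  0<fromℕ : ∀ n → 0# < fromℕ (suc n)
  0<fromℕ n = <-≤-trans 0<1 (certificate (0≤fromℕ n)
    (solve 1 (λ x → (lit 1 :+ x) :- lit 1 := x) refl (fromℕ n)))

  +-pos-nonneg : ∀ {x y} → 0# < x → 0# ≤ y → 0# < x + y
  +-pos-nonneg {x} {y} 0<x 0≤y = <-≤-trans 0<x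
    (certificate 0≤y (solve 2 (λ x y → (x :+ y) :- x := y) refl x y))

  inverseʳ : ∀ {x} → 0# < x → x * x ⁻¹ ≡ 1#
  inverseʳ (_ , 0≢x) = ⁻¹-inverseʳ _ λ x≡0 → 0≢x (sym x≡0)

  ⁻¹-nonneg : ∀ {x} → 0# < x → 0# ≤ x ⁻¹
  ⁻¹-nonneg {x} 0<x with ≤-total 0# (x ⁻¹)
  ... | inj₁ p = p
  ... | inj₂ p = contradiction
    (certificate {1#} {0#} (proj₁ 0<x ⊗ difference p) (begin
      0# - 1#            ≡⟨ cong (λ z → 0# - z) (sym (inverseʳ 0<x)) ⟩
      0# - x * x ⁻¹      ≡⟨ solve 2 (λ x y → lit 0 :- x :* y := x :* (lit 0 :- y)) refl x (x ⁻¹) ⟩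
      x * (0# - x ⁻¹)    ∎))
    (<⇒≱ 0<1)

  *-cancelˡ : ∀ {z x y} → 0# < z → z * x ≤ z * y → x ≤ y
  *-cancelˡ {z} {x} {y} 0<z p = certificate (⁻¹-nonneg 0<z ⊗ difference p) (begin
    y - x                     ≡⟨ sym (*-identityˡ _) ⟩
    1# * (y - x)              ≡⟨ cong (_* (y - x)) (sym (inverseʳ 0<z)) ⟩
    z * z ⁻¹ * (y - x)        ≡⟨ solve 4 (λ z i x y → z :* i :* (y :- x) := i :* (z :* y :- z :* x))
                                   refl z (z ⁻¹) x y ⟩
    z ⁻¹ * (z * y - z * x)    ∎)

  *-pos : ∀ {x y} → 0# < x → 0# < y → 0# < x * y
  *-pos {x} {y} 0<x 0<y = ≰⇒> λ p →
    <⇒≱ 0<y (*-cancelˡ 0<x (subst (x * y ≤_) (sym (zeroʳ x)) p))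

  ⁻¹-pos : ∀ {x} → 0# < x → 0# < x ⁻¹
  ⁻¹-pos {x} 0<x = ⁻¹-nonneg 0<x , λ 0≡x⁻¹ →
    0#≢1# (trans (sym (zeroʳ x)) (trans (cong (x *_) 0≡x⁻¹) (inverseʳ 0<x)))

  square-cancel-≤ : ∀ {x y} → 0# ≤ y → x * x ≤ y * y → x ≤ y
  square-cancel-≤ {x} {y} 0≤y p with x ≤? y
  ... | yes x≤y = x≤y
  ... | no  x≰y = *-cancelˡ 0<x+y (certificate (difference p)
        (solve 2 (λ x y → (x :+ y) :* y :- (x :+ y) :* x := y :* y :- x :* x) refl x y))
    where
    0<x+y : 0# < x + y
    0<x+y = ≰⇒> λ q → x≰y (certificate (difference q ⊕ (0≤y ⊕ 0≤y))
      (solve 2 (λ x y → y :- x := (lit 0 :- (x :+ y)) :+ (y :+ y)) refl x y))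

  -- The cross term is the mean inequality without roots: (x y′ + x′ y)² = (x y′ - x′ y)² + 4 (x
  -- y)(x′ y′), and the last product is at least b² b′².
  cauchy : ∀ {b b′ x x′ y y′} → 0# ≤ b → 0# ≤ b′ → 0# ≤ x → 0# ≤ x′ → 0# ≤ y → 0# ≤ y′ →
           b * b ≤ x * y → b′ * b′ ≤ x′ * y′ →
           (b + b′) * (b + b′) ≤ (x + x′) * (y + y′)
  cauchy {b} {b′} {x} {x′} {y} {y′} 0≤b 0≤b′ 0≤x 0≤x′ 0≤y 0≤y′ p p′ =
    certificate (difference cross ⊕ difference p ⊕ difference p′)
      (solve 6 (λ b b′ x x′ y y′ →
          (x :+ x′) :* (y :+ y′) :- (b :+ b′) :* (b :+ b′) :=
          (x :* y′ :+ x′ :* y :- (b :* b′ :+ b :* b′)) :+ (x :* y :- b :* b) :+ (x′ :* y′ :- b′ :* b′))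
        refl b b′ x x′ y y′)
    where
    cross : b * b′ + b * b′ ≤ x * y′ + x′ * y
    cross = square-cancel-≤ (0≤x ⊗ 0≤y′ ⊕ 0≤x′ ⊗ 0≤y) (certificate
      (square-nonneg (x * y′ - x′ * y) ⊕
        0≤fromℕ 4 ⊗ (difference p ⊗ (0≤x′ ⊗ 0≤y′) ⊕ square-nonneg b ⊗ difference p′))
      (solve 6 (λ b b′ x x′ y y′ →
          (x :* y′ :+ x′ :* y) :* (x :* y′ :+ x′ :* y) :- (b :* b′ :+ b :* b′) :* (b :* b′ :+ b :* b′) :=
          (x :* y′ :- x′ :* y) :* (x :* y′ :- x′ :* y) :+
            lit 4 :* ((x :* y :- b :* b) :* (x′ :* y′) :+ b :* b :* (x′ :* y′ :- b′ :* b′)))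
        refl b b′ x x′ y y′))

  -- Finite sums: Cauchy-Schwarz and sums over the image of an injection

  sum-nonneg : ∀ {n} {f : Fin n → Carrier} → (∀ i → 0# ≤ f i) → 0# ≤ sum f
  sum-nonneg {zero}  p = ≤-refl
  sum-nonneg {suc n} p = p zero ⊕ sum-nonneg λ i → p (suc i)

  sum-mono : ∀ {n} {f g : Fin n → Carrier} → (∀ i → f i ≤ g i) → sum f ≤ sum g
  sum-mono {zero}  p = ≤-refl
  sum-mono {suc n} p = +-mono (p zero) (sum-mono λ i → p (suc i))

  sum-cauchy : ∀ {n} {b x y : Fin n → Carrier} →
               (∀ i → 0# ≤ b i) → (∀ i → 0# ≤ x i) → (∀ i → 0# ≤ y i) →
               (∀ i → b i * b i ≤ x i * y i) → sum b * sum b ≤ sum x * sum y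
  sum-cauchy {zero}  0≤b 0≤x 0≤y p = ≤-refl
  sum-cauchy {suc n} 0≤b 0≤x 0≤y p = cauchy (0≤b zero) (sum-nonneg λ i → 0≤b (suc i))
    (0≤x zero) (sum-nonneg λ i → 0≤x (suc i)) (0≤y zero) (sum-nonneg λ i → 0≤y (suc i)) (p zero)
    (sum-cauchy (λ i → 0≤b (suc i)) (λ i → 0≤x (suc i)) (λ i → 0≤y (suc i)) (λ i → p (suc i)))

  indicator : ∀ {n} → Fin n → Fin n → Carrier
  indicator zero    zero    = 1#
  indicator zero    (suc _) = 0#
  indicator (suc _) zero    = 0#
  indicator (suc i) (suc j) = indicator i j

  indicator-refl : ∀ {n} (i : Fin n) → indicator i i ≡ 1#
  indicator-refl zero    = refl
  indicator-refl (suc i) = indicator-refl i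

  indicator-≢ : ∀ {n} {i j : Fin n} → i ≢ j → indicator i j ≡ 0#
  indicator-≢ {i = zero}  {zero}  i≢j = contradiction refl i≢j
  indicator-≢ {i = zero}  {suc j} i≢j = refl
  indicator-≢ {i = suc i} {zero}  i≢j = refl
  indicator-≢ {i = suc i} {suc j} i≢j = indicator-≢ λ i≡j → i≢j (cong suc i≡j)

  sum-zero : ∀ {n} {f : Fin n → Carrier} → (∀ i → f i ≡ 0#) → sum f ≡ 0#
  sum-zero {n} p = trans (sum-cong-≗ p) (sum-replicate-zero n)

  sum-indicator : ∀ {n} (i : Fin n) (f : Fin n → Carrier) →
                  sum (λ a → indicator i a * f a) ≡ f i
  sum-indicator zero    f = trans (cong₂ _+_ (*-identityˡ _) (sum-zero {f = λ a → 0# * f (suc a)} λ a → zeroˡ (f (suc a)))) (+-identityʳ _)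
  sum-indicator (suc i) f = trans (cong₂ _+_ (zeroˡ _) (sum-indicator i λ a → f (suc a))) (+-identityˡ _)

  sum-image : ∀ {j n} (σ : Fin j → Fin n) → Injective _≡_ _≡_ σ → (f : Fin n → Carrier) →
              (∀ a → (∀ i → σ i ≢ a) → f a ≡ 0#) → sum f ≡ sum (λ i → f (σ i))
  sum-image {j} σ σ-inj f off = begin
    sum f                                              ≡⟨ sum-cong-≗ expand ⟩
    sum (λ a → sum (λ i → indicator (σ i) a * f a))    ≡⟨ ∑-comm (λ a i → indicator (σ i) a * f a) ⟩
    sum (λ i → sum (λ a → indicator (σ i) a * f a))    ≡⟨ sum-cong-≗ (λ i → sum-indicator (σ i) f) ⟩
    sum (λ i → f (σ i))                                ∎
    where
    indicator-σ : ∀ i i′ → indicator (σ i) (σ i′) ≡ indicator i′ i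
    indicator-σ i i′ with i′ Fin.≟ i
    ... | yes refl = trans (indicator-refl (σ i)) (sym (indicator-refl i))
    ... | no i′≢i  = trans (indicator-≢ λ eq → i′≢i (sym (σ-inj eq))) (sym (indicator-≢ i′≢i))

    expand : ∀ a → f a ≡ sum (λ i → indicator (σ i) a * f a)
    expand a with Fin.any? (λ i → σ i Fin.≟ a)
    ... | yes (i′ , refl) = sym (trans
          (sum-cong-≗ λ i → cong (_* f (σ i′)) (indicator-σ i i′))
          (sum-indicator i′ λ _ → f (σ i′)))
    ... | no ∄i = trans fa≡0 (sym (sum-zero λ i → trans (cong (indicator (σ i) a *_) fa≡0) (zeroʳ _)))
      where fa≡0 = off a λ i eq → ∄i (i , eq)

  -- Separates a draw into items that carry a label and a lump of all others, which share the
  -- continuation value `C`. The hypothesis keeps the factor `w a`, so items of weight 0 satisfy it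
  -- whatever their continuation. Subtracting `C` makes the summand vanish off the image of `σ`.
  sum-split : ∀ {j n} (σ : Fin j → Fin n) → Injective _≡_ _≡_ σ →
              (w G : Fin n → Carrier) (C : Carrier) →
              (∀ a → (∀ i → σ i ≢ a) → w a * G a ≡ w a * C) →
              sum (λ a → w a * G a) ≡
                sum (λ i → w (σ i) * G (σ i)) + (sum w - sum (λ i → w (σ i))) * C
  sum-split σ σ-inj w G C off = begin
    sum (λ a → w a * G a)
      ≡⟨ excess w G ⟩
    sum (λ a → w a * (G a - C)) + sum w * C
      ≡⟨ cong (_+ sum w * C) (sum-image σ σ-inj (λ a → w a * (G a - C)) λ a unseen → begin
           w a * (G a - C)      ≡⟨ solve 3 (λ w g c → w :* (g :- c) := w :* g :- w :* c) refl (w a) (G a) C ⟩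
           w a * G a - w a * C  ≡⟨ cong (_- w a * C) (off a unseen) ⟩
           w a * C - w a * C    ≡⟨ -‿inverseʳ _ ⟩
           0#                   ∎) ⟩
    S + sum w * C
      ≡⟨ solve 4 (λ s w v c → s :+ w :* c := (s :+ v :* c) :+ (w :- v) :* c) refl S (sum w) V C ⟩
    (S + V * C) + (sum w - V) * C
      ≡⟨ cong (_+ (sum w - V) * C) (sym (excess (λ i → w (σ i)) (λ i → G (σ i)))) ⟩
    sum (λ i → w (σ i) * G (σ i)) + (sum w - V) * C ∎
    where
    S = sum (λ i → w (σ i) * (G (σ i) - C))
    V = sum (λ i → w (σ i))
    excess : ∀ {n} (w G : Fin n → Carrier) →
             sum (λ a → w a * G a) ≡ sum (λ a → w a * (G a - C)) + sum w * C
    excess w G = begin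
      sum (λ a → w a * G a)
        ≡⟨ sum-cong-≗ (λ a → solve 3 (λ w g c → w :* g := w :* (g :- c) :+ w :* c) refl (w a) (G a) C) ⟩
      sum (λ a → w a * (G a - C) + w a * C)
        ≡⟨ ∑-distrib-+ (λ a → w a * (G a - C)) (λ a → w a * C) ⟩
      sum (λ a → w a * (G a - C)) + sum (λ a → w a * C)
        ≡⟨ cong (sum (λ a → w a * (G a - C)) +_) (sym (*-distribʳ-sum C w)) ⟩
      sum (λ a → w a * (G a - C)) + sum w * C ∎

-- Runs described by labels instead of items

module CanonicalProcess {c ℓ} (F : ArchimedeanOrderedField c ℓ) where
  open ArchimedeanOrderedField F
  open ProportionalSetting F
  open FieldProperties F
  open Solver using (solve; _:=_; _:+_; _:*_; _:-_)
  open ≡-Reasoning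

  -- A run on an instance of total weight W, with the sampled items replaced by
  -- labels: v holds the weights of the labels, ls the labels of the held items,
  -- and an unlabelled item (of weight 1) receives the label zero when drawn.
  canonical : (φ : Carrier → Carrier) (W : Carrier) → ∀ {m k j} →
              (Fin j → Carrier) → Vec (Fin j) k → Program m k → Carrier
  canonical φ W v ls (return x)     = φ x
  canonical φ W v ls (sample κ)     =
    (sum (λ i → v i * canonical φ W v (i ∷ᵥ ls) (κ (v i)))
      + (W - sum v) * canonical φ W (1# ∷ v) (zero ∷ᵥ Vec.map suc ls) (κ 1#)) * W ⁻¹
  canonical φ W v ls (same? i j κ)  =
    canonical φ W v ls (κ (does (lookup ls i Fin.≟ lookup ls j)))
  canonical φ W v ls (flip q _ _ κ) =
    q * canonical φ W v ls (κ true) + (1# - q) * canonical φ W v ls (κ false)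

  payoff : ∀ {p} {P : Pred Carrier p} → Decidable P → Carrier → Carrier
  payoff P? x = if does (P? x) then 1# else 0#

  does-≟-injective : ∀ {j n} {σ : Fin j → Fin n} → Injective _≡_ _≡_ σ →
                     ∀ a b → does (σ a Fin.≟ σ b) ≡ does (a Fin.≟ b)
  does-≟-injective {σ = σ} σ-inj a b with σ a Fin.≟ σ b | a Fin.≟ b
  ... | yes _     | yes _    = refl
  ... | no _      | no _     = refl
  ... | yes σa≡σb | no a≢b   = contradiction (σ-inj σa≡σb) a≢b
  ... | no σa≢σb  | yes refl = contradiction refl σa≢σb

  module _ {n p} (I : Instance n) {P : Pred Carrier p} (P? : Decidable P) where
    open Instance I

    -- `σ` embeds the labels into the items. A program learns only weights and equalities, and
    -- injectivity of `σ` preserves the latter. A fresh draw `a` extends `σ` to `a ∷ σ`; as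
    -- unlabelled items weigh 0 or 1, all that can be drawn lead to the same value, whichever `a` it
    -- was.
    PrFrom≡canonical : ∀ {m k j} (v : Fin j → Carrier) (ls : Vec (Fin j) k) (prog : Program m k)
      (σ : Fin j → Fin n) → Injective _≡_ _≡_ σ → (∀ i → w (σ i) ≡ v i) →
      (∀ a → (∀ i → σ i ≢ a) → w a ≡ 0# ⊎ w a ≡ 1#) →
      PrFrom I P? (Vec.map σ ls) prog ≡ canonical (payoff P?) W v ls prog
    PrFrom≡canonical v ls (return x) σ σ-inj w∘σ unseen = refl
    PrFrom≡canonical v ls (same? i j κ) σ σ-inj w∘σ unseen = trans
      (cong (λ β → PrFrom I P? (Vec.map σ ls) (κ β)) (begin
        does (lookup (Vec.map σ ls) i Fin.≟ lookup (Vec.map σ ls) j)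
          ≡⟨ cong₂ (λ a b → does (a Fin.≟ b)) (Vec.lookup-map i σ ls) (Vec.lookup-map j σ ls) ⟩
        does (σ (lookup ls i) Fin.≟ σ (lookup ls j))
          ≡⟨ does-≟-injective σ-inj (lookup ls i) (lookup ls j) ⟩
        does (lookup ls i Fin.≟ lookup ls j) ∎))
      (PrFrom≡canonical v ls (κ _) σ σ-inj w∘σ unseen)
    PrFrom≡canonical v ls (flip q _ _ κ) σ σ-inj w∘σ unseen =
      cong₂ (λ x y → q * x + (1# - q) * y)
        (PrFrom≡canonical v ls (κ true)  σ σ-inj w∘σ unseen)
        (PrFrom≡canonical v ls (κ false) σ σ-inj w∘σ unseen)
    PrFrom≡canonical {j = j} v ls (sample κ) σ σ-inj w∘σ unseen = begin
      sum (λ a → (w a / W) * G a)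
        ≡⟨ sum-cong-≗ (λ a → solve 3 (λ x r g → x :* r :* g := x :* g :* r) refl (w a) (W ⁻¹) (G a)) ⟩
      sum (λ a → w a * G a * W ⁻¹)
        ≡⟨ sym (*-distribʳ-sum (W ⁻¹) (λ a → w a * G a)) ⟩
      sum (λ a → w a * G a) * W ⁻¹
        ≡⟨ cong (_* W ⁻¹) (sum-split σ σ-inj w G C off) ⟩
      (sum (λ i → w (σ i) * G (σ i)) + (W - sum (λ i → w (σ i))) * C) * W ⁻¹
        ≡⟨ cong₂ (λ x y → (x + (W - y) * C) * W ⁻¹)
             (sum-cong-≗ old) (sum-cong-≗ w∘σ) ⟩
      canonical (payoff P?) W v ls (sample κ) ∎
      where
      G : Fin n → Carrier
      G a = PrFrom I P? (a ∷ᵥ Vec.map σ ls) (κ (w a))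

      C : Carrier
      C = canonical (payoff P?) W (1# ∷ v) (zero ∷ᵥ Vec.map suc ls) (κ 1#)

      old : ∀ i → w (σ i) * G (σ i) ≡ v i * canonical (payoff P?) W v (i ∷ᵥ ls) (κ (v i))
      old i rewrite w∘σ i = cong (v i *_) (PrFrom≡canonical v (i ∷ᵥ ls) (κ (v i)) σ σ-inj w∘σ unseen)

      new : ∀ a → (∀ i → σ i ≢ a) → w a ≡ 1# → G a ≡ C
      new a a∉σ wa≡1 = begin
        PrFrom I P? (a ∷ᵥ Vec.map σ ls) (κ (w a))
          ≡⟨ cong₂ (λ as x → PrFrom I P? (a ∷ᵥ as) (κ x)) (Vec.map-∘ σ′ suc ls) wa≡1 ⟩
        PrFrom I P? (Vec.map σ′ (zero ∷ᵥ Vec.map suc ls)) (κ 1#)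
          ≡⟨ PrFrom≡canonical (1# ∷ v) (zero ∷ᵥ Vec.map suc ls) (κ 1#) σ′ σ′-inj
               (λ { zero → wa≡1 ; (suc i) → w∘σ i })
               (λ b b∉σ′ → unseen b λ i → b∉σ′ (suc i)) ⟩
        C ∎
        where
        σ′ : Fin (suc j) → Fin n
        σ′ = a ∷ σ

        σ′-inj : Injective _≡_ _≡_ σ′
        σ′-inj {zero}  {zero}  _  = refl
        σ′-inj {zero}  {suc i} eq = contradiction (sym eq) (a∉σ i)
        σ′-inj {suc i} {zero}  eq = contradiction eq (a∉σ i)
        σ′-inj {suc i} {suc _} eq = cong suc (σ-inj eq)

      off : ∀ a → (∀ i → σ i ≢ a) → w a * G a ≡ w a * C
      off a a∉σ with unseen a a∉σ
      ... | inj₁ wa≡0 = trans (cong (_* G a) wa≡0)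
                          (trans (zeroˡ _) (sym (trans (cong (_* C) wa≡0) (zeroˡ _))))
      ... | inj₂ wa≡1 = cong (w a *_) (new a a∉σ wa≡1)

  remaining : ∀ {V W} u → V + fromℕ u ≡ W → W - V ≡ fromℕ u
  remaining {V} u refl = solve 2 (λ V x → V :+ x :- V := x) refl V (fromℕ u)

  remaining-suc : ∀ {V W} u → V + fromℕ (suc u) ≡ W → (1# + V) + fromℕ u ≡ W
  remaining-suc {V} u refl = solve 2 (λ V x → (lit 1 :+ V) :+ x := V :+ (lit 1 :+ x)) refl V (fromℕ u)

  1∷-nonneg : ∀ {j} {v : Fin j → Carrier} → (∀ i → 0# ≤ v i) → ∀ i → 0# ≤ (1# ∷ v) i
  1∷-nonneg 0≤v zero    = 0≤1
  1∷-nonneg 0≤v (suc i) = 0≤v i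

  -- `u` counts the unlabelled light items. If none is left, the invariant cannot be restored after
  -- a fresh draw, but then the branch has weight 0; otherwise it continues with `u` lowered by one.
  fresh-mono : ∀ {V W C D} u → V + fromℕ u ≡ W →
               (∀ u′ → (1# + V) + fromℕ u′ ≡ W → C ≤ D) → (W - V) * C ≤ (W - V) * D
  fresh-mono {C = C} {D} zero eq p = ≤-reflexive (begin
    _ * C    ≡⟨ cong (_* C) (remaining 0 eq) ⟩
    0# * C   ≡⟨ trans (zeroˡ C) (sym (zeroˡ D)) ⟩
    0# * D   ≡⟨ cong (_* D) (sym (remaining 0 eq)) ⟩
    _ * D    ∎)
  fresh-mono (suc u) eq p =
    *-monoˡ (subst (0# ≤_) (sym (remaining (suc u) eq)) (0≤fromℕ (suc u))) (p u (remaining-suc u eq))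

  fresh-nonneg : ∀ {V W C} u → V + fromℕ u ≡ W →
                 (∀ u′ → (1# + V) + fromℕ u′ ≡ W → 0# ≤ C) → 0# ≤ (W - V) * C
  fresh-nonneg {V} {W} {C} u eq p = subst (_≤ (W - V) * C) (zeroʳ (W - V)) (fresh-mono u eq p)

  module _ {W : Carrier} (0<W : 0# < W) where

    canonical-nonneg : ∀ {φ} → (∀ x → 0# ≤ φ x) → ∀ {m k j} {v : Fin j → Carrier}
      (ls : Vec (Fin j) k) (prog : Program m k) → (∀ i → 0# ≤ v i) →
      ∀ u → sum v + fromℕ u ≡ W → 0# ≤ canonical φ W v ls prog
    canonical-nonneg 0≤φ ls (return x) 0≤v u eq = 0≤φ x
    canonical-nonneg 0≤φ ls (sample κ) 0≤v u eq =
      ( sum-nonneg (λ i → 0≤v i ⊗ canonical-nonneg 0≤φ (i ∷ᵥ ls) (κ _) 0≤v u eq)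
      ⊕ fresh-nonneg u eq (canonical-nonneg 0≤φ (zero ∷ᵥ Vec.map suc ls) (κ 1#) (1∷-nonneg 0≤v))
      ) ⊗ ⁻¹-nonneg 0<W
    canonical-nonneg 0≤φ ls (same? i j κ) 0≤v u eq = canonical-nonneg 0≤φ ls (κ _) 0≤v u eq
    canonical-nonneg 0≤φ ls (flip q 0≤q q≤1 κ) 0≤v u eq =
      0≤q ⊗ canonical-nonneg 0≤φ ls (κ true) 0≤v u eq ⊕
      difference q≤1 ⊗ canonical-nonneg 0≤φ ls (κ false) 0≤v u eq

    -- The branches of a draw have weights `v i` and `W - sum v`, which add up to `W`; so a
    -- pointwise bound on `φ + ψ` survives averaging.
    canonical-disjoint : ∀ {φ ψ} → (∀ x → φ x + ψ x ≤ 1#) → ∀ {m k j} {v : Fin j → Carrier}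
      (ls : Vec (Fin j) k) (prog : Program m k) → (∀ i → 0# ≤ v i) →
      ∀ u → sum v + fromℕ u ≡ W → canonical φ W v ls prog + canonical ψ W v ls prog ≤ 1#
    canonical-disjoint φ+ψ≤1 ls (return x) 0≤v u eq = φ+ψ≤1 x
    canonical-disjoint φ+ψ≤1 ls (same? i j κ) 0≤v u eq = canonical-disjoint φ+ψ≤1 ls (κ _) 0≤v u eq
    canonical-disjoint φ+ψ≤1 ls (flip q 0≤q q≤1 κ) 0≤v u eq = certificate
      ( 0≤q ⊗ difference (canonical-disjoint φ+ψ≤1 ls (κ true) 0≤v u eq)
      ⊕ difference q≤1 ⊗ difference (canonical-disjoint φ+ψ≤1 ls (κ false) 0≤v u eq))
      (solve 5 (λ q x x′ y y′ →
          lit 1 :- ((q :* x :+ (lit 1 :- q) :* x′) :+ (q :* y :+ (lit 1 :- q) :* y′)) :=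
          q :* (lit 1 :- (x :+ y)) :+ (lit 1 :- q) :* (lit 1 :- (x′ :+ y′)))
        refl q _ _ _ _)
    canonical-disjoint {φ} {ψ} φ+ψ≤1 {j = j} {v} ls (sample κ) 0≤v u eq = certificate
      ((difference old ⊕ difference new) ⊗ ⁻¹-nonneg 0<W) (begin
      1# - ((Σx + (W - sum v) * x) * W ⁻¹ + (Σy + (W - sum v) * y) * W ⁻¹)
        ≡⟨ cong (_- ((Σx + (W - sum v) * x) * W ⁻¹ + (Σy + (W - sum v) * y) * W ⁻¹)) (sym (inverseʳ 0<W)) ⟩
      W * W ⁻¹ - ((Σx + (W - sum v) * x) * W ⁻¹ + (Σy + (W - sum v) * y) * W ⁻¹)
        ≡⟨ solve 7 (λ W r V a x b y →
             W :* r :- ((a :+ (W :- V) :* x) :* r :+ (b :+ (W :- V) :* y) :* r) :=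
             ((V :- (a :+ b)) :+ ((W :- V) :* lit 1 :- (W :- V) :* (x :+ y))) :* r)
             refl W (W ⁻¹) (sum v) Σx x Σy y ⟩
      ((sum v - (Σx + Σy)) + ((W - sum v) * 1# - (W - sum v) * (x + y))) * W ⁻¹ ∎)
      where
      x y Σx Σy : Carrier
      x = canonical φ W (1# ∷ v) (zero ∷ᵥ Vec.map suc ls) (κ 1#)
      y = canonical ψ W (1# ∷ v) (zero ∷ᵥ Vec.map suc ls) (κ 1#)

      xs ys : Fin j → Carrier
      xs i = canonical φ W v (i ∷ᵥ ls) (κ (v i))
      ys i = canonical ψ W v (i ∷ᵥ ls) (κ (v i))
      Σx = sum (λ i → v i * xs i)
      Σy = sum (λ i → v i * ys i)

      old : Σx + Σy ≤ sum v
      old = subst (_≤ sum v) (∑-distrib-+ (λ i → v i * xs i) (λ i → v i * ys i))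
        (sum-mono λ i → certificate
          (0≤v i ⊗ difference (canonical-disjoint φ+ψ≤1 (i ∷ᵥ ls) (κ (v i)) 0≤v u eq))
          (solve 3 (λ v x y → v :- (v :* x :+ v :* y) := v :* (lit 1 :- (x :+ y)))
            refl (v i) (xs i) (ys i)))

      new : (W - sum v) * (x + y) ≤ (W - sum v) * 1#
      new = fresh-mono u eq
        (canonical-disjoint φ+ψ≤1 (zero ∷ᵥ Vec.map suc ls) (κ 1#) (1∷-nonneg 0≤v))

    canonical-≤1 : ∀ {φ} → (∀ x → φ x ≤ 1#) → ∀ {m k j} {v : Fin j → Carrier}
      (ls : Vec (Fin j) k) (prog : Program m k) → (∀ i → 0# ≤ v i) →
      ∀ u → sum v + fromℕ u ≡ W → canonical φ W v ls prog ≤ 1#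
    -- The special case `ψ = 0`; its expected payoff is only known here to be nonnegative, which
    -- suffices.
    canonical-≤1 {φ} φ≤1 {v = v} ls prog 0≤v u eq = ≤-trans
      (certificate (canonical-nonneg {φ = λ _ → 0#} (λ _ → ≤-refl) ls prog 0≤v u eq)
        (solve 2 (λ x y → (x :+ y) :- x := y) refl (canonical φ W v ls prog) _))
      (canonical-disjoint {ψ = λ _ → 0#} (λ x → subst (_≤ 1#) (sym (+-identityʳ (φ x))) (φ≤1 x))
        ls prog 0≤v u eq)

-- Second-moment comparison of the two total weights

module Comparison {c ℓ} (F : ArchimedeanOrderedField c ℓ) where
  open ArchimedeanOrderedField F
  open ProportionalSetting F
  open FieldProperties F
  open Solver using (solve; _:=_; _:+_; _:*_; _:-_)
  open CanonicalProcess F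
  open ≡-Reasoning
  open SemiringExp (CommutativeRing.semiring commutativeRing) using (_^_)

  1≤^ : ∀ {s} → 0# ≤ s → ∀ m → 1# ≤ (1# + s) ^ m
  1≤^ 0≤s zero = ≤-refl
  1≤^ {s} 0≤s (suc m) = certificate (difference (1≤^ 0≤s m) ⊕ 0≤s ⊗ ≤-trans 0≤1 (1≤^ 0≤s m))
    (solve 2 (λ s p → (lit 1 :+ s) :* p :- lit 1 := (p :- lit 1) :+ s :* p) refl s ((1# + s) ^ m))

  0≤^ : ∀ {s} → 0# ≤ s → ∀ m → 0# ≤ (1# + s) ^ m
  0≤^ 0≤s m = ≤-trans 0≤1 (1≤^ 0≤s m)

  scaled : ∀ {z b x y} → 0# ≤ z → b * b ≤ x * y → (z * b) * (z * b) ≤ (z * x) * (z * y)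
  scaled {z} {b} {x} {y} 0≤z p = certificate ((0≤z ⊗ 0≤z) ⊗ difference p)
    (solve 4 (λ z b x y → (z :* x) :* (z :* y) :- (z :* b) :* (z :* b) :=
                          (z :* z) :* (x :* y :- b :* b)) refl z b x y)

  -- `θ` is the charge for each light item seen. A fresh light item comes with probability at most
  -- k′ / W′, so `drift` makes `τ` a bound on the expected charge per draw. `gap` bounds the excess
  -- of the second moment in one draw by `s`, and is asked for only below the threshold. Writing the
  -- difference of the totals as `suc d` leaves an unseen light item under `W` even when none is
  -- left under `W′`.
  record Parameters : Set (c ⊔ ℓ) where
    field
      W W′ H θ τ s : Carrier
      k′ d         : ℕ
      0<W          : 0# < W
      0<W′         : 0# < W′
      W≡           : W′ + fromℕ (suc d) ≡ W
      W′≡          : H + fromℕ k′ ≡ W′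
      0≤θ          : 0# ≤ θ
      0≤τ          : 0# ≤ τ
      0≤s          : 0# ≤ s
      drift        : θ * fromℕ k′ ≤ τ * W′
      gap          : ∀ j → ¬ 1# ≤ fromℕ j * θ →
                     fromℕ (suc d) * fromℕ (suc d) * (H + fromℕ j)
                       ≤ s * (W - (H + fromℕ j)) * (W′ * W′)

  module _ (params : Parameters) where
    open Parameters params

    X : Carrier
    X = 1# + s

    0≤X^ : ∀ m → 0# ≤ X ^ m
    0≤X^ = 0≤^ 0≤s

    -- Markov bound for the event that 1/θ light items are seen, when j of them
    -- already have been and m samples are left.
    T : ℕ → ℕ → Carrier
    T m j = fromℕ j * θ + fromℕ m * τ

    0≤T : ∀ m j → 0# ≤ T m j
    0≤T m j = 0≤fromℕ j ⊗ 0≤θ ⊕ 0≤fromℕ m ⊗ 0≤τ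

    -- x and y are the expected payoffs for W′ and W.  Up to the truncation
    -- error t, Cauchy–Schwarz bounds x² by y times the second moment of the
    -- likelihood ratio, which grows by a factor of at most X with each sample.
    record Close (m : ℕ) (t x y : Carrier) : Set (c ⊔ ℓ) where
      constructor close
      field
        b   : Carrier
        0≤b : 0# ≤ b
        x≤  : x ≤ b + t
        b²≤ : b * b ≤ y * X ^ m

    truncated : ∀ {m t x y} → x ≤ t → 0# ≤ y → Close m t x y
    truncated {m} {t} {x} {y} x≤t 0≤y = close 0# ≤-refl
      (subst (x ≤_) (sym (+-identityˡ t)) x≤t)
      (subst (_≤ y * X ^ m) (sym (zeroˡ 0#)) (0≤y ⊗ 0≤X^ m))

    -- A coin has the same law under both weights, so the second moment gains no factor: in
    -- Cauchy-Schwarz the second factor is split as q X^m + (1 - q) X^m.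
    flip-close : ∀ {m t q x x′ y y′} → 0# ≤ q → q ≤ 1# → 0# ≤ y → 0# ≤ y′ →
                 Close m t x y → Close m t x′ y′ →
                 Close m t (q * x + (1# - q) * x′) (q * y + (1# - q) * y′)
    flip-close {m} {t} {q} {x} {x′} {y} {y′} 0≤q q≤1 0≤y 0≤y′ (close b 0≤b x≤ b²≤) (close b′ 0≤b′ x′≤ b′²≤) =
      close (q * b + p * b′) (0≤q ⊗ 0≤b ⊕ 0≤p ⊗ 0≤b′)
        (certificate (0≤q ⊗ difference x≤ ⊕ 0≤p ⊗ difference x′≤)
          (solve 6 (λ q b b′ t x x′ →
              (q :* b :+ (lit 1 :- q) :* b′ :+ t) :- (q :* x :+ (lit 1 :- q) :* x′) :=
              q :* (b :+ t :- x) :+ (lit 1 :- q) :* (b′ :+ t :- x′)) refl q b b′ t x x′))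
        (subst ((q * b + p * b′) * (q * b + p * b′) ≤_)
          (solve 4 (λ q y y′ z →
              (q :* y :+ (lit 1 :- q) :* y′) :* (q :* z :+ (lit 1 :- q) :* z) :=
              (q :* y :+ (lit 1 :- q) :* y′) :* z) refl q y y′ (X ^ m))
          (cauchy (0≤q ⊗ 0≤b) (0≤p ⊗ 0≤b′) (0≤q ⊗ 0≤y) (0≤p ⊗ 0≤y′)
            (0≤q ⊗ 0≤X^ m) (0≤p ⊗ 0≤X^ m) (scaled 0≤q b²≤) (scaled 0≤p b′²≤)))
      where
      p : Carrier
      p = 1# - q

      0≤p : 0# ≤ p
      0≤p = difference q≤1

    module SampleStep {m n j u : ℕ} (v : Fin n → Carrier) (0≤v : ∀ i → 0# ≤ v i)
      (V≡ : sum v ≡ H + fromℕ j) (V+u≡ : sum v + fromℕ u ≡ W′) (good : ¬ 1# ≤ fromℕ j * θ)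
      (x y : Fin n → Carrier) (x₀ y₀ : Carrier) (0≤y : ∀ i → 0# ≤ y i)
      (0≤fresh-y₀ : 0# ≤ (W - sum v) * y₀)
      (old : ∀ i → Close m (T m j) (x i) (y i))
      (new : ∀ u′ → (1# + sum v) + fromℕ u′ ≡ W′ → Close m (T m (suc j)) x₀ y₀)
      where

      -- `f` and `f′` are the unseen weights under `W` and `W′`. The second moment of the likelihood
      -- ratio of this draw is (W / W′²)(V + f′² / f), so it is at most `X` exactly when V + f′² / f
      -- ≤ `Z`.
      V f f′ e Y Z : Carrier
      V  = sum v
      f  = W - V
      f′ = W′ - V
      e  = fromℕ (suc d)
      Y  = X ^ m
      Z  = X * (W′ * W′) * W ⁻¹

      0≤f′ : 0# ≤ f′
      0≤f′ = subst (0# ≤_) (sym (remaining u V+u≡)) (0≤fromℕ u)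

      f≡ : f ≡ f′ + e
      f≡ = trans (cong (_- V) (sym W≡)) (solve 3 (λ w e v → w :+ e :- v := w :- v :+ e) refl W′ e V)

      0<f : 0# < f
      0<f = subst (0# <_) (trans (+-comm e f′) (sym f≡)) (+-pos-nonneg (0<fromℕ d) 0≤f′)

      f′≤k′ : f′ ≤ fromℕ k′
      f′≤k′ = certificate (0≤fromℕ j) (begin
        fromℕ k′ - (W′ - V)
          ≡⟨ cong₂ (λ w v → fromℕ k′ - (w - v)) (sym W′≡) V≡ ⟩
        fromℕ k′ - (H + fromℕ k′ - (H + fromℕ j))
          ≡⟨ solve 3 (λ h k j → k :- (h :+ k :- (h :+ j)) := j) refl H (fromℕ k′) (fromℕ j) ⟩
        fromℕ j ∎)

      -- With V + f = W, V + f′ = W′ and f = f′ + e, clearing the denominator W uses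
      -- W (f′² + f V) = f W′² + e² V.
      ratio : f′ * f′ ≤ f * (Z - V)
      ratio = *-cancelˡ 0<W (certificate
        (difference (subst₂ (λ z z′ → e * e * z ≤ s * (W - z′) * (W′ * W′)) (sym V≡) (sym V≡) (gap j good)))
        (begin
        W * (f * (Z - V)) - W * (f′ * f′)
          ≡⟨ solve 7 (λ W f X Q r V f′ →
               W :* (f :* (X :* Q :* r :- V)) :- W :* (f′ :* f′) :=
               f :* X :* Q :* (W :* r) :- W :* (f :* V :+ f′ :* f′))
               refl W f X (W′ * W′) (W ⁻¹) V f′ ⟩
        f * X * (W′ * W′) * (W * W ⁻¹) - W * (f * V + f′ * f′)
          ≡⟨ cong₂ (λ o w → f * X * (W′ * W′) * o - w * (f * V + f′ * f′)) (inverseʳ 0<W) (sym W≡) ⟩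
        f * X * (W′ * W′) * 1# - (W′ + e) * (f * V + f′ * f′)
          ≡⟨ cong (λ f → f * X * (W′ * W′) * 1# - (W′ + e) * (f * V + f′ * f′)) f≡ ⟩
        (f′ + e) * X * (W′ * W′) * 1# - (W′ + e) * ((f′ + e) * V + f′ * f′)
          ≡⟨ solve 4 (λ W′ V e s →
               ((W′ :- V) :+ e) :* (lit 1 :+ s) :* (W′ :* W′) :* lit 1 :-
                 (W′ :+ e) :* (((W′ :- V) :+ e) :* V :+ (W′ :- V) :* (W′ :- V)) :=
               s :* (W′ :+ e :- V) :* (W′ :* W′) :- e :* e :* V)
               refl W′ V e s ⟩
        s * (W′ + e - V) * (W′ * W′) - e * e * V
          ≡⟨ cong (λ w → s * (w - V) * (W′ * W′) - e * e * V) W≡ ⟩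
        s * (W - V) * (W′ * W′) - e * e * V ∎))

      0≤Z-V : 0# ≤ Z - V
      0≤Z-V = *-cancelˡ 0<f (subst (_≤ f * (Z - V)) (sym (zeroʳ f))
                (≤-trans (square-nonneg f′) ratio))

      -- The bounds carry the factor `f′` because `W′` may have no unseen light item while `W` still
      -- has some. Then `new` is not applicable, but `f′` is 0 and any values would do.
      record Fresh : Set (c ⊔ ℓ) where
        field
          b₀   : Carrier
          0≤b₀ : 0# ≤ b₀
          x₀≤  : f′ * x₀ ≤ f′ * (b₀ + T m (suc j))
          b₀²≤ : f′ * (b₀ * b₀) ≤ f′ * (y₀ * Y)

      fresh : ∀ u → V + fromℕ u ≡ W′ → Fresh
      fresh zero eq = record
        { b₀ = 0#
        ; 0≤b₀ = ≤-refl
        ; x₀≤ = ≤-reflexive (vanish x₀ (0# + T m (suc j)))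
        ; b₀²≤ = ≤-reflexive (vanish (0# * 0#) (y₀ * Y))
        }
        where
        vanish : ∀ p q → f′ * p ≡ f′ * q
        vanish p q rewrite remaining 0 eq = trans (zeroˡ p) (sym (zeroˡ q))
      fresh (suc u) eq = record
        { b₀ = b
        ; 0≤b₀ = 0≤b
        ; x₀≤ = *-monoˡ 0≤f′ x≤
        ; b₀²≤ = *-monoˡ 0≤f′ b²≤
        }
        where open Close (new u (remaining-suc u eq))

      open Fresh (fresh u V+u≡)

      bs : Fin n → Carrier
      bs i = Close.b (old i)

      Σb Σx Σy : Carrier
      Σb = sum (λ i → v i * bs i)
      Σx = sum (λ i → v i * x i)
      Σy = sum (λ i → v i * y i)

      0≤Σb : 0# ≤ Σb
      0≤Σb = sum-nonneg λ i → 0≤v i ⊗ Close.0≤b (old i)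

      0≤Σy : 0# ≤ Σy
      0≤Σy = sum-nonneg λ i → 0≤v i ⊗ 0≤y i

      Σx≤ : Σx ≤ Σb + V * T m j
      Σx≤ = subst (Σx ≤_) (begin
        sum (λ i → v i * (bs i + T m j))
          ≡⟨ sum-cong-≗ (λ i → distribˡ (v i) (bs i) (T m j)) ⟩
        sum (λ i → v i * bs i + v i * T m j)
          ≡⟨ ∑-distrib-+ (λ i → v i * bs i) (λ i → v i * T m j) ⟩
        Σb + sum (λ i → v i * T m j)
          ≡⟨ cong (Σb +_) (sym (*-distribʳ-sum (T m j) v)) ⟩
        Σb + V * T m j ∎)
        (sum-mono λ i → *-monoˡ (0≤v i) (Close.x≤ (old i)))

      Σb²≤ : Σb * Σb ≤ Σy * (V * Y)
      Σb²≤ = subst (λ z → Σb * Σb ≤ Σy * z) (sym (*-distribʳ-sum Y v))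
        (sum-cauchy (λ i → 0≤v i ⊗ Close.0≤b (old i)) (λ i → 0≤v i ⊗ 0≤y i)
          (λ i → 0≤v i ⊗ 0≤X^ m) (λ i → scaled (0≤v i) (Close.b²≤ (old i))))

      fresh²≤ : (f′ * b₀) * (f′ * b₀) ≤ (f * y₀) * ((Z - V) * Y)
      fresh²≤ = ≤-trans
        (certificate (0≤f′ ⊗ difference b₀²≤)
          (solve 3 (λ f b z → f :* f :* z :- (f :* b) :* (f :* b) := f :* (f :* z :- f :* (b :* b)))
            refl f′ b₀ (y₀ * Y)))
        -- Multiplying by `f` brings out `f * y₀`, the quantity given as nonnegative, next to the
        -- difference from `ratio`.
        (*-cancelˡ 0<f (certificate
          ((difference ratio ⊗ 0≤fresh-y₀) ⊗ 0≤X^ m)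
          (solve 5 (λ f f′ z y w →
              f :* ((f :* y) :* (z :* w)) :- f :* (f′ :* f′ :* (y :* w)) :=
              (f :* z :- f′ :* f′) :* (f :* y) :* w) refl f f′ (Z - V) y₀ Y)))

      b : Carrier
      b = (Σb + f′ * b₀) * W′ ⁻¹

      -- In Cauchy-Schwarz over the old labels and the fresh branch, the second factors V Y and (Z -
      -- V) Y add up to Z Y. Division by W′² turns `Z` into X / W, which yields one more power of
      -- `X` and the normalisation for `W`.
      b²≤ : b * b ≤ (Σy + f * y₀) * W ⁻¹ * (X * Y)
      b²≤ = certificate
        (difference (cauchy 0≤Σb (0≤f′ ⊗ 0≤b₀) 0≤Σy 0≤fresh-y₀
           (sum-nonneg 0≤v ⊗ 0≤X^ m) (0≤Z-V ⊗ 0≤X^ m) Σb²≤ fresh²≤)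
         ⊗ square-nonneg (W′ ⁻¹))
        (begin
        A * W ⁻¹ * (X * Y) - b * b
          ≡⟨ solve 6 (λ A r X Y B r′ →
               A :* r :* (X :* Y) :- (B :* r′) :* (B :* r′) :=
               A :* r :* (X :* Y) :* (lit 1 :* lit 1) :- (B :* r′) :* (B :* r′))
               refl A (W ⁻¹) X Y B (W′ ⁻¹) ⟩
        A * W ⁻¹ * (X * Y) * (1# * 1#) - b * b
          ≡⟨ cong (λ o → A * W ⁻¹ * (X * Y) * (o * o) - b * b) (sym (inverseʳ 0<W′)) ⟩
        A * W ⁻¹ * (X * Y) * (W′ * W′ ⁻¹ * (W′ * W′ ⁻¹)) - b * b
          ≡⟨ solve 8 (λ A r X Y W′ r′ B V →
               A :* r :* (X :* Y) :* (W′ :* r′ :* (W′ :* r′)) :- (B :* r′) :* (B :* r′) :=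
               (A :* (V :* Y :+ (X :* (W′ :* W′) :* r :- V) :* Y) :- B :* B) :* (r′ :* r′))
               refl A (W ⁻¹) X Y W′ (W′ ⁻¹) B V ⟩
        (A * (V * Y + (Z - V) * Y) - B * B) * (W′ ⁻¹ * W′ ⁻¹) ∎)
        where
        A B : Carrier
        A = Σy + f * y₀
        B = Σb + f′ * b₀

      -- As V + f′ = W′, the errors of the branches average to T m j + θ f′ / W′, and f′ ≤ k′ with
      -- `drift` bounds the last term by `τ`, the charge for this draw.
      x≤ : (Σx + f′ * x₀) * W′ ⁻¹ ≤ b + T (suc m) j
      x≤ = certificate
        ((difference Σx≤ ⊕ difference x₀≤ ⊕ 0≤θ ⊗ difference f′≤k′ ⊕ difference drift)
          ⊗ ⁻¹-nonneg 0<W′)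
        (begin
        b + T (suc m) j - (Σx + f′ * x₀) * W′ ⁻¹
          ≡⟨ solve 6 (λ b j θ m τ x →
               b :+ (j :* θ :+ (lit 1 :+ m) :* τ) :- x := b :+ lit 1 :* (j :* θ :+ (lit 1 :+ m) :* τ) :- x)
               refl b (fromℕ j) θ (fromℕ m) τ ((Σx + f′ * x₀) * W′ ⁻¹) ⟩
        b + 1# * T (suc m) j - (Σx + f′ * x₀) * W′ ⁻¹
          ≡⟨ cong (λ o → b + o * T (suc m) j - (Σx + f′ * x₀) * W′ ⁻¹) (sym (inverseʳ 0<W′)) ⟩
        b + W′ * W′ ⁻¹ * T (suc m) j - (Σx + f′ * x₀) * W′ ⁻¹
          ≡⟨ solve 12 (λ B b₀ W′ r V j θ m τ X x₀ k →
               (B :+ (W′ :- V) :* b₀) :* r :+ W′ :* r :* (j :* θ :+ (lit 1 :+ m) :* τ) :-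
                 (X :+ (W′ :- V) :* x₀) :* r :=
               ((B :+ V :* (j :* θ :+ m :* τ) :- X)
                 :+ ((W′ :- V) :* (b₀ :+ ((lit 1 :+ j) :* θ :+ m :* τ)) :- (W′ :- V) :* x₀)
                 :+ θ :* (k :- (W′ :- V)) :+ (τ :* W′ :- θ :* k)) :* r)
               refl Σb b₀ W′ (W′ ⁻¹) V (fromℕ j) θ (fromℕ m) τ Σx x₀ (fromℕ k′) ⟩
        ((Σb + V * T m j - Σx)
          + (f′ * (b₀ + T m (suc j)) - f′ * x₀)
          + θ * (fromℕ k′ - f′) + (τ * W′ - θ * fromℕ k′)) * W′ ⁻¹ ∎)

      result : Close (suc m) (T (suc m) j)
                 ((Σx + f′ * x₀) * W′ ⁻¹) ((Σy + f * y₀) * W ⁻¹)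
      result = close b ((0≤Σb ⊕ 0≤f′ ⊗ 0≤b₀) ⊗ ⁻¹-nonneg 0<W′) x≤ b²≤

    module _ {φ : Carrier → Carrier} (0≤φ : ∀ x → 0# ≤ φ x) (φ≤1 : ∀ x → φ x ≤ 1#) where

      larger : ∀ {V} u → V + fromℕ u ≡ W′ → V + fromℕ (u ℕ.+ suc d) ≡ W
      larger {V} u eq = begin
        V + fromℕ (u ℕ.+ suc d)           ≡⟨ cong (V +_) (fromℕ-+ u (suc d)) ⟩
        V + (fromℕ u + fromℕ (suc d))     ≡⟨ sym (+-assoc _ _ _) ⟩
        V + fromℕ u + fromℕ (suc d)       ≡⟨ cong (_+ fromℕ (suc d)) eq ⟩
        W′ + fromℕ (suc d)                ≡⟨ W≡ ⟩
        W                                 ∎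

      -- The same labels `v` serve both totals: `j` counts the light ones among them, `u` the light
      -- items still unlabelled under `W′`.
      canonical-close : ∀ {m k n} {v : Fin n → Carrier} (ls : Vec (Fin n) k) (prog : Program m k) →
        (∀ i → 0# ≤ v i) → ∀ j u → sum v ≡ H + fromℕ j → sum v + fromℕ u ≡ W′ →
        Close m (T m j) (canonical φ W′ v ls prog) (canonical φ W v ls prog)
      -- Here b = φ x, and b² ≤ φ x * X ^ m because φ x ≤ 1 ≤ X ^ m.
      canonical-close {m} ls (return x) 0≤v j u V≡ V+u≡ = close (φ x) (0≤φ x)
        (certificate (0≤T m j) (solve 2 (λ x t → x :+ t :- x := t) refl (φ x) (T m j)))
        (*-monoˡ (0≤φ x) (≤-trans (φ≤1 x) (1≤^ 0≤s m)))
      canonical-close ls (same? a b κ) 0≤v j u V≡ V+u≡ = canonical-close ls (κ _) 0≤v j u V≡ V+u≡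
      canonical-close ls (flip q 0≤q q≤1 κ) 0≤v j u V≡ V+u≡ = flip-close 0≤q q≤1
        (canonical-nonneg 0<W 0≤φ ls (κ true)  0≤v (u ℕ.+ suc d) (larger u V+u≡))
        (canonical-nonneg 0<W 0≤φ ls (κ false) 0≤v (u ℕ.+ suc d) (larger u V+u≡))
        (canonical-close ls (κ true)  0≤v j u V≡ V+u≡)
        (canonical-close ls (κ false) 0≤v j u V≡ V+u≡)
      canonical-close {suc m} {v = v} ls prog@(sample κ) 0≤v j u V≡ V+u≡ with 1# ≤? fromℕ j * θ
      -- Past the threshold the error term alone is at least 1, hence exceeds any expected payoff,
      -- and b = 0 will do.
      ... | yes bad = truncated
            (≤-trans (canonical-≤1 0<W′ φ≤1 ls prog 0≤v u V+u≡)
              (≤-trans bad (certificate (0≤fromℕ (suc m) ⊗ 0≤τ)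
                (solve 2 (λ x y → x :+ y :- x := y) refl (fromℕ j * θ) (fromℕ (suc m) * τ)))))
            (canonical-nonneg 0<W 0≤φ ls prog 0≤v (u ℕ.+ suc d) (larger u V+u≡))
      ... | no good = SampleStep.result {j = j} {u} v 0≤v V≡ V+u≡ good
            (λ i → canonical φ W′ v (i ∷ᵥ ls) (κ (v i))) (λ i → canonical φ W v (i ∷ᵥ ls) (κ (v i)))
            (canonical φ W′ (1# ∷ v) (zero ∷ᵥ Vec.map suc ls) (κ 1#))
            (canonical φ W  (1# ∷ v) (zero ∷ᵥ Vec.map suc ls) (κ 1#))
            (λ i → canonical-nonneg 0<W 0≤φ (i ∷ᵥ ls) (κ (v i)) 0≤v (u ℕ.+ suc d) (larger u V+u≡))
            (fresh-nonneg (u ℕ.+ suc d) (larger u V+u≡)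
              (canonical-nonneg 0<W 0≤φ (zero ∷ᵥ Vec.map suc ls) (κ 1#) (1∷-nonneg 0≤v)))
            (λ i → canonical-close (i ∷ᵥ ls) (κ (v i)) 0≤v j u V≡ V+u≡)
            (λ u′ eq → canonical-close (zero ∷ᵥ Vec.map suc ls) (κ 1#) (1∷-nonneg 0≤v) (suc j) u′
              (trans (cong (1# +_) V≡)
                (solve 2 (λ h j → lit 1 :+ (h :+ j) := h :+ (lit 1 :+ j)) refl H (fromℕ j))) eq)

-- Both sides of the crossing are used: `Q d` limits how much weight is removed, and failure at
-- `suc d` makes the approximation intervals disjoint.
bounded-search : ∀ {q} {Q : Pred ℕ q} → Decidable Q → ∀ k → Q 0 → ¬ Q k →
                 ∃ λ d → d ℕ.< k × Q d × ¬ Q (suc d)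
bounded-search Q? zero    Q0 ¬Qk = contradiction Q0 ¬Qk
bounded-search Q? (suc k) Q0 ¬Qk with Q? k
... | yes Qk = k , ℕ.n<1+n k , Qk , ¬Qk
... | no ¬Qk′ with bounded-search Q? k Q0 ¬Qk′
...   | d , d<k , Qd , ¬Qd+1 = d , ℕ.m<n⇒m<1+n d<k , Qd , ¬Qd+1

-- The hard instances

module HardInstances {c ℓ} (F : ArchimedeanOrderedField c ℓ) where
  open ArchimedeanOrderedField F
  open ProportionalSetting F
  open FieldProperties F
  open CanonicalProcess F

  lights : (p k : ℕ) → Fin k → Carrier
  lights zero    k       i       = 0#
  lights (suc p) (suc k) zero    = 1#
  lights (suc p) (suc k) (suc i) = lights p k i

  sum-lights : ∀ {p k} → p ℕ.≤ k → sum (lights p k) ≡ fromℕ p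
  sum-lights {k = k} z≤n = sum-replicate-zero k
  sum-lights (s≤s p≤k)   = cong (1# +_) (sum-lights p≤k)

  lights-0-1 : ∀ p k i → lights p k i ≡ 0# ⊎ lights p k i ≡ 1#
  lights-0-1 zero    k       i       = inj₁ refl
  lights-0-1 (suc p) (suc k) zero    = inj₂ refl
  lights-0-1 (suc p) (suc k) (suc i) = lights-0-1 p k i

  lights-nonneg : ∀ p k i → 0# ≤ lights p k i
  lights-nonneg p k i with lights-0-1 p k i
  ... | inj₁ eq = subst (0# ≤_) (sym eq) ≤-refl
  ... | inj₂ eq = subst (0# ≤_) (sym eq) 0≤1

  module _ {H : Carrier} (0<H : 0# < H) {p k : ℕ} (p≤k : p ℕ.≤ k) where

    hard : Instance (suc k)
    hard = record
      { w   = H ∷ lights p k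
      ; w≥0 = λ { zero → proj₁ 0<H ; (suc i) → lights-nonneg p k i }
      ; W>0 = +-pos-nonneg 0<H (sum-nonneg (lights-nonneg p k))
      }

    W-hard : Instance.W hard ≡ H + fromℕ p
    W-hard = cong (H +_) (sum-lights p≤k)

    -- The heavy item is labelled before any draw, though not yet held, since only items of weight 0
    -- or 1 may be unlabelled.
    Pr-hard : ∀ {m} (A : Algorithm m) ε →
      Pr[ A on hard outputs isApproximation? ε (Instance.W hard) ] ≡
      canonical (payoff (isApproximation? ε (H + fromℕ p))) (H + fromℕ p) {j = 1} (λ _ → H) [] A
    Pr-hard A ε = trans
      (PrFrom≡canonical hard (isApproximation? ε (Instance.W hard)) {j = 1} (λ _ → H) [] A (λ _ → zero)
        (λ { {zero} {zero} _ → refl }) (λ _ → refl)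
        (λ { zero unseen → contradiction refl (unseen zero) ; (suc i) _ → lights-0-1 p k i }))
      (cong (λ W → canonical (payoff (isApproximation? ε W)) W {j = 1} (λ _ → H) [] A) W-hard)

-- Choice of the parameters and the numerical contradiction

module LowerBound {c ℓ} (F : ArchimedeanOrderedField c ℓ) where
  open ArchimedeanOrderedField F
  open ProportionalSetting F
  open FieldProperties F
  open Solver using (solve; _:=_; _:+_; _:*_; _:-_)
  open CanonicalProcess F
  open Comparison F
  open HardInstances F
  open SemiringExp (CommutativeRing.semiring commutativeRing) using (_^_)
  open ≡-Reasoning

  payoff-nonneg : ∀ {p} {P : Pred Carrier p} (P? : Decidable P) x → 0# ≤ payoff P? x
  payoff-nonneg P? x with P? x
  ... | yes _ = 0≤1
  ... | no  _ = ≤-refl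

  payoff-≤1 : ∀ {p} {P : Pred Carrier p} (P? : Decidable P) x → payoff P? x ≤ 1#
  payoff-≤1 P? x with P? x
  ... | yes _ = ≤-refl
  ... | no  _ = 0≤1

  payoff-disjoint : ∀ {p q} {P : Pred Carrier p} {Q : Pred Carrier q}
    (P? : Decidable P) (Q? : Decidable Q) → (∀ x → P x → ¬ Q x) →
    ∀ x → payoff P? x + payoff Q? x ≤ 1#
  payoff-disjoint P? Q? disjoint x with P? x | Q? x
  ... | yes Px | yes Qx = contradiction Qx (disjoint x Px)
  ... | yes _  | no  _  = ≤-reflexive (+-identityʳ 1#)
  ... | no  _  | yes _  = ≤-reflexive (+-identityˡ 1#)
  ... | no  _  | no  _  = subst (_≤ 1#) (sym (+-identityˡ 0#)) 0≤1

  -- A division-free form of (1 + s)^m ≤ 1 / (1 - m s). Passing from m to m + 1 lowers the left side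
  -- by (1 + s)^m (m + 1) s².
  power-bound : ∀ {s} → 0# ≤ s → ∀ m → (1# + s) ^ m * (1# - fromℕ m * s) ≤ 1#
  power-bound {s} 0≤s zero = ≤-reflexive (solve 1 (λ s → lit 1 :* (lit 1 :- lit 0 :* s) := lit 1) refl s)
  power-bound {s} 0≤s (suc m) = ≤-trans
    (certificate ((0≤^ 0≤s m ⊗ 0≤fromℕ (suc m)) ⊗ (0≤s ⊗ 0≤s))
      (solve 3 (λ s p m → p :* (lit 1 :- m :* s) :- (lit 1 :+ s) :* p :* (lit 1 :- (lit 1 :+ m) :* s) :=
                          p :* (lit 1 :+ m) :* (s :* s))
        refl s ((1# + s) ^ m) (fromℕ m)))
    (power-bound 0≤s m)

  -- From x ≥ 2/3 and t ≤ 1/15 follows b ≥ 3/5, and 16 m s ≤ 1 gives (1 + s)^m ≤ 16/15. Hence y ≥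
  -- (9/25)(15/16) = 27/80, whereas z ≥ 2/3 forces y ≤ 1/3. The certificate is this comparison times
  -- 1200: 405 against 400.
  incompatible : ∀ {q x y z b t s} m → fromℕ 3 * q ≡ fromℕ 2 → 0# ≤ s →
    q ≤ x → q ≤ z → y + z ≤ 1# → x ≤ b + t → 0# ≤ y → b * b ≤ y * (1# + s) ^ m →
    fromℕ 15 * t ≤ 1# → fromℕ 16 * (fromℕ m * s) ≤ 1# → ⊥
  incompatible {q} {x} {y} {z} {b} {t} {s} m 3q≡2 0≤s q≤x q≤z y+z≤1 x≤ 0≤y b²≤ 15t≤1 16ms≤1 =
    <⇒≱ (0<fromℕ 4) (certificate {fromℕ 5} {0#}
      ( 0≤fromℕ 45 ⊗ (0≤5b-3 ⊗ (0≤5b-3 ⊕ 0≤fromℕ 6))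
      ⊕ 0≤fromℕ 1125 ⊗ difference b²≤
      ⊕ 0≤fromℕ 75 ⊗ (0≤y ⊗ difference 15P≤16)
      ⊕ 0≤fromℕ 400 ⊗ ((0≤fromℕ 3 ⊗ difference q≤z) ⊕ 0≤fromℕ 3 ⊗ difference y+z≤1))
      (begin
      0# - fromℕ 5
        ≡⟨ solve 0 (lit 0 :- lit 5 := lit 795 :- lit 400 :* lit 2) refl ⟩
      fromℕ 795 - fromℕ 400 * fromℕ 2
        ≡⟨ cong (λ two → fromℕ 795 - fromℕ 400 * two) (sym 3q≡2) ⟩
      fromℕ 795 - fromℕ 400 * (fromℕ 3 * q)
        ≡⟨ solve 5 (λ q y z b P →
             lit 795 :- lit 400 :* (lit 3 :* q) :=
             lit 45 :* ((lit 5 :* b :- lit 3) :* (lit 5 :* b :- lit 3 :+ lit 6))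
               :+ lit 1125 :* (y :* P :- b :* b)
               :+ lit 75 :* (y :* (lit 16 :- lit 15 :* P))
               :+ lit 400 :* (lit 3 :* (z :- q) :+ lit 3 :* (lit 1 :- (y :+ z))))
             refl q y z b P ⟩
      fromℕ 45 * ((fromℕ 5 * b - fromℕ 3) * (fromℕ 5 * b - fromℕ 3 + fromℕ 6))
        + fromℕ 1125 * (y * P - b * b)
        + fromℕ 75 * (y * (fromℕ 16 - fromℕ 15 * P))
        + fromℕ 400 * (fromℕ 3 * (z - q) + fromℕ 3 * (1# - (y + z))) ∎))
    where
    P : Carrier
    P = (1# + s) ^ m

    0≤5b-3 : 0# ≤ fromℕ 5 * b - fromℕ 3
    0≤5b-3 = difference (*-cancelˡ (0<fromℕ 2) (certificate
      (0≤fromℕ 15 ⊗ difference x≤ ⊕ 0≤fromℕ 15 ⊗ difference q≤x ⊕ difference 15t≤1)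
      (begin
      fromℕ 3 * (fromℕ 5 * b) - fromℕ 3 * fromℕ 3
        ≡⟨ solve 1 (λ b → lit 3 :* (lit 5 :* b) :- lit 3 :* lit 3 :=
                          lit 15 :* b :+ lit 1 :- lit 5 :* lit 2) refl b ⟩
      fromℕ 15 * b + 1# - fromℕ 5 * fromℕ 2
        ≡⟨ cong (λ two → fromℕ 15 * b + 1# - fromℕ 5 * two) (sym 3q≡2) ⟩
      fromℕ 15 * b + 1# - fromℕ 5 * (fromℕ 3 * q)
        ≡⟨ solve 4 (λ b t q x →
             lit 15 :* b :+ lit 1 :- lit 5 :* (lit 3 :* q) :=
             lit 15 :* (b :+ t :- x) :+ lit 15 :* (x :- q) :+ (lit 1 :- lit 15 :* t))
             refl b t q x ⟩
      fromℕ 15 * (b + t - x) + fromℕ 15 * (x - q) + (1# - fromℕ 15 * t) ∎)))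

    15P≤16 : fromℕ 15 * P ≤ fromℕ 16
    15P≤16 = certificate
      ( 0≤fromℕ 16 ⊗ difference (power-bound 0≤s m)
      ⊕ 0≤^ 0≤s m ⊗ difference 16ms≤1)
      (solve 3 (λ P m s → lit 16 :- lit 15 :* P :=
          lit 16 :* (lit 1 :- P :* (lit 1 :- m :* s)) :+ P :* (lit 1 :- lit 16 :* (m :* s)))
        refl P (fromℕ m) s)

  -- k is a square because F need not contain √k.
  module Gap {ε g : Carrier} (0<ε : 0# < ε) (0<g : 0# < g) (g≤1-ε : g ≤ 1# - ε)
    (r : ℕ) (1≤R : 1# ≤ fromℕ r) (4≤gR : fromℕ 4 ≤ g * fromℕ r) where

    k : ℕ
    k = r ℕ.* r

    R K ε⁻¹ H h W G κ : Carrier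
    R   = fromℕ r
    K   = fromℕ k
    ε⁻¹ = ε ⁻¹
    H   = R * ε⁻¹
    h   = H ⁻¹
    W   = H + K
    G   = g ⁻¹
    κ   = K ⁻¹

    0≤ε : 0# ≤ ε
    0≤ε = proj₁ 0<ε

    K≡ : K ≡ R * R
    K≡ = fromℕ-* r r

    0<R : 0# < R
    0<R = <-≤-trans 0<1 1≤R

    0<K : 0# < K
    0<K = subst (0# <_) (sym K≡) (*-pos 0<R 0<R)

    0<H : 0# < H
    0<H = *-pos 0<R (⁻¹-pos 0<ε)

    0<W : 0# < W
    0<W = +-pos-nonneg 0<H (proj₁ 0<K)

    εH≡R : ε * H ≡ R
    εH≡R = begin
      ε * (R * ε⁻¹)   ≡⟨ solve 3 (λ e R i → e :* (R :* i) := R :* (e :* i)) refl ε R ε⁻¹ ⟩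
      R * (ε * ε⁻¹)   ≡⟨ cong (R *_) (inverseʳ 0<ε) ⟩
      R * 1#          ≡⟨ *-identityʳ R ⟩
      R               ∎

    gR≤gK : g * R ≤ g * K
    gR≤gK = *-monoˡ (proj₁ 0<g) (subst₂ _≤_ (*-identityʳ R) (sym K≡) (*-monoˡ (proj₁ 0<R) 1≤R))

    0≤1-ε : 0# ≤ 1# - ε
    0≤1-ε = ≤-trans (proj₁ 0<g) g≤1-ε

    -- Without light items only `H` remains. Since ε H = R, the difference (1 - ε)(H + K) - (1 + ε)
    -- H is (1 - ε) K - 2 R, at least g R² - 2 R, and 4 ≤ g R makes this at least 2 R.
    far-at-k : ¬ (1# - ε) * W ≤ (1# + ε) * (W - fromℕ k)
    far-at-k p = <⇒≱ (*-pos (0<fromℕ 1) 0<R) (certificate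
      ( difference p
      ⊕ difference g≤1-ε ⊗ proj₁ 0<K
      ⊕ difference 4≤gR ⊗ proj₁ 0<R)
      (begin
      0# - fromℕ 2 * R
        ≡⟨ solve 3 (λ g K R → lit 0 :- lit 2 :* R := lit 2 :* R :- g :* K :+ g :* K :- lit 4 :* R) refl g K R ⟩
      fromℕ 2 * R - g * K + g * K - fromℕ 4 * R
        ≡⟨ cong₂ (λ x y → fromℕ 2 * x - g * K + g * y - fromℕ 4 * R) (sym εH≡R) K≡ ⟩
      fromℕ 2 * (ε * H) - g * K + g * (R * R) - fromℕ 4 * R
        ≡⟨ solve 5 (λ ε H g K R →
             lit 2 :* (ε :* H) :- g :* K :+ g :* (R :* R) :- lit 4 :* R :=
             (lit 1 :+ ε) :* (H :+ K :- K) :- (lit 1 :- ε) :* (H :+ K)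
               :+ (lit 1 :- ε :- g) :* K :+ (g :* R :- lit 4) :* R)
             refl ε H g K R ⟩
      (1# + ε) * (W - K) - (1# - ε) * W + (1# - ε - g) * K + (g * R - fromℕ 4) * R ∎))

    close-at-0 : (1# - ε) * W ≤ (1# + ε) * (W - fromℕ 0)
    close-at-0 = certificate ((0≤ε ⊕ 0≤ε) ⊗ proj₁ 0<W)
      (solve 2 (λ ε W → (lit 1 :+ ε) :* (W :- lit 0) :- (lit 1 :- ε) :* W := (ε :+ ε) :* W) refl ε W)

    search : ∃ λ d → d ℕ.< k × (1# - ε) * W ≤ (1# + ε) * (W - fromℕ d) ×
                     ¬ (1# - ε) * W ≤ (1# + ε) * (W - fromℕ (suc d))
    search = bounded-search (λ d → (1# - ε) * W ≤? (1# + ε) * (W - fromℕ d)) k close-at-0 far-at-k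

    d k′ : ℕ
    d  = proj₁ search
    k′ = k ℕ.∸ suc d

    e D W′ : Carrier
    e  = fromℕ (suc d)
    D  = fromℕ d
    W′ = H + fromℕ k′

    k′≤k : k′ ℕ.≤ k
    k′≤k = ℕ.m∸n≤m k (suc d)

    k′+e≡K : fromℕ k′ + e ≡ K
    k′+e≡K = trans (sym (fromℕ-+ k′ (suc d))) (cong fromℕ (ℕ.m∸n+n≡m (proj₁ (proj₂ search))))

    W′+e≡W : W′ + e ≡ W
    W′+e≡W = trans (+-assoc _ _ _) (cong (H +_) k′+e≡K)

    0<W′ : 0# < W′
    0<W′ = +-pos-nonneg 0<H (0≤fromℕ k′)

    W-D≡ : W - D ≡ W′ + 1#
    W-D≡ = trans (cong (_- D) (sym W′+e≡W))
      (solve 2 (λ w d → w :+ (lit 1 :+ d) :- d := w :+ lit 1) refl W′ D)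

    close-at-d : (1# - ε) * W ≤ (1# + ε) * (W′ + 1#)
    close-at-d = subst (λ z → (1# - ε) * W ≤ (1# + ε) * z) W-D≡ (proj₁ (proj₂ (proj₂ search)))

    separated : ¬ (1# - ε) * W ≤ (1# + ε) * W′
    separated p = proj₂ (proj₂ (proj₂ search))
      (subst (λ z → (1# - ε) * W ≤ (1# + ε) * z)
        (trans (solve 2 (λ w e → w := w :+ e :- e) refl W′ e) (cong (_- e) W′+e≡W)) p)

    -- Closeness at `d` gives d ≤ 2 ε W; the one further item in `e` is absorbed by 1 ≤ R = ε H ≤ ε
    -- W.
    e≤3εW : e ≤ fromℕ 3 * (ε * W)
    e≤3εW = certificate
      (difference close-at-d ⊕ 0≤ε ⊗ 0≤fromℕ d ⊕ 0≤ε ⊗ proj₁ 0<K ⊕ difference 1≤R)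
      (begin
      fromℕ 3 * (ε * W) - e
        ≡⟨ solve 4 (λ ε H K d →
             lit 3 :* (ε :* (H :+ K)) :- (lit 1 :+ d) :=
             lit 2 :* (ε :* (H :+ K)) :- d :+ ε :* K :+ (ε :* H :- lit 1)) refl ε H K D ⟩
      fromℕ 2 * (ε * W) - D + ε * K + (ε * H - 1#)
        ≡⟨ cong (λ R → fromℕ 2 * (ε * W) - D + ε * K + (R - 1#)) εH≡R ⟩
      fromℕ 2 * (ε * W) - D + ε * K + (R - 1#)
        ≡⟨ solve 5 (λ ε W D K R →
             lit 2 :* (ε :* W) :- D :+ ε :* K :+ (R :- lit 1) :=
             (lit 1 :+ ε) :* (W :- D) :- (lit 1 :- ε) :* W :+ ε :* D :+ ε :* K :+ (R :- lit 1))
             refl ε W D K R ⟩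
      (1# + ε) * (W - D) - (1# - ε) * W + ε * D + ε * K + (R - 1#)
        ≡⟨ cong (λ z → (1# + ε) * z - (1# - ε) * W + ε * D + ε * K + (R - 1#)) W-D≡ ⟩
      (1# + ε) * (W′ + 1#) - (1# - ε) * W + ε * D + ε * K + (R - 1#) ∎)

    -- Closeness at `d` gives g W ≤ 2 (W′ + 1). After doubling, the constant 4 is absorbed by one
    -- copy of g W, because g W ≥ g K ≥ g R ≥ 4.
    gW≤4W′ : g * W ≤ fromℕ 4 * W′
    gW≤4W′ = certificate
      ( 0≤fromℕ 2 ⊗ (difference close-at-d ⊕ 0≤1-ε ⊗ (proj₁ 0<W′ ⊕ 0≤1)
                      ⊕ difference g≤1-ε ⊗ proj₁ 0<W)
      ⊕ (proj₁ 0<g ⊗ proj₁ 0<H ⊕ difference (≤-trans 4≤gR gR≤gK)))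
      (solve 5 (λ ε g H K W′ →
          lit 4 :* W′ :- g :* (H :+ K) :=
          lit 2 :* ((lit 1 :+ ε) :* (W′ :+ lit 1) :- (lit 1 :- ε) :* (H :+ K)
                    :+ (lit 1 :- ε) :* (W′ :+ lit 1) :+ (lit 1 :- ε :- g) :* (H :+ K))
            :+ (g :* H :+ (g :* K :- lit 4)))
        refl ε g H K W′)

    square-mono : ∀ {x y} → 0# ≤ x → x ≤ y → x * x ≤ y * y
    square-mono {x} {y} 0≤x x≤y = certificate (difference x≤y ⊗ (0≤x ⊕ ≤-trans 0≤x x≤y))
      (solve 2 (λ x y → y :* y :- x :* x := (y :- x) :* (x :+ y)) refl x y)

    W²≤ : W * W ≤ fromℕ 16 * (G * G) * (W′ * W′)
    W²≤ = certificate
      ((⁻¹-nonneg 0<g ⊗ ⁻¹-nonneg 0<g) ⊗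
        difference (square-mono (proj₁ 0<g ⊗ proj₁ 0<W) gW≤4W′))
      (begin
      fromℕ 16 * (G * G) * (W′ * W′) - W * W
        ≡⟨ solve 3 (λ G W W′ →
             lit 16 :* (G :* G) :* (W′ :* W′) :- W :* W :=
             lit 16 :* (G :* G) :* (W′ :* W′) :- lit 1 :* lit 1 :* (W :* W)) refl G W W′ ⟩
      fromℕ 16 * (G * G) * (W′ * W′) - 1# * 1# * (W * W)
        ≡⟨ cong (λ o → fromℕ 16 * (G * G) * (W′ * W′) - o * o * (W * W)) (sym (inverseʳ 0<g)) ⟩
      fromℕ 16 * (G * G) * (W′ * W′) - g * G * (g * G) * (W * W)
        ≡⟨ solve 4 (λ g G W W′ →
             lit 16 :* (G :* G) :* (W′ :* W′) :- g :* G :* (g :* G) :* (W :* W) :=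
             G :* G :* (lit 4 :* W′ :* (lit 4 :* W′) :- g :* W :* (g :* W))) refl g G W W′ ⟩
      G * G * (fromℕ 4 * W′ * (fromℕ 4 * W′) - g * W * (g * W)) ∎)

    -- While j θ < 1, at most half of the light items and a light weight of at most
    -- H / 2 have been seen; 432 = 3 · 3² · 4², from e ≤ 3 ε W and g W ≤ 4 W′.
    θ τ s : Carrier
    θ = fromℕ 2 * h + fromℕ 2 * κ
    τ = fromℕ 2 * h
    s = fromℕ 432 * (G * G) * h

    0≤h : 0# ≤ h
    0≤h = ⁻¹-nonneg 0<H

    0≤κ : 0# ≤ κ
    0≤κ = ⁻¹-nonneg 0<K

    -- The right side is 2 (H + k′) / H = 2 + 2 k′ / H, and the 2 contributed by the heavy item pays
    -- for 2 k′ / K.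
    drift : θ * fromℕ k′ ≤ τ * W′
    drift = certificate (0≤fromℕ 2 ⊗ (0≤κ ⊗ 0≤fromℕ (suc d))) (begin
      τ * W′ - θ * fromℕ k′
        ≡⟨ solve 4 (λ h H κ k′ →
             lit 2 :* h :* (H :+ k′) :- (lit 2 :* h :+ lit 2 :* κ) :* k′ :=
             lit 2 :* (H :* h) :- lit 2 :* (κ :* k′)) refl h H κ (fromℕ k′) ⟩
      fromℕ 2 * (H * h) - fromℕ 2 * (κ * fromℕ k′)
        ≡⟨ cong (λ o → fromℕ 2 * o - fromℕ 2 * (κ * fromℕ k′))
             (trans (inverseʳ 0<H) (sym (inverseʳ 0<K))) ⟩
      fromℕ 2 * (K * κ) - fromℕ 2 * (κ * fromℕ k′)
        ≡⟨ cong (λ K → fromℕ 2 * (K * κ) - fromℕ 2 * (κ * fromℕ k′)) (sym k′+e≡K) ⟩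
      fromℕ 2 * ((fromℕ k′ + e) * κ) - fromℕ 2 * (κ * fromℕ k′)
        ≡⟨ solve 3 (λ k′ e κ → lit 2 :* ((k′ :+ e) :* κ) :- lit 2 :* (κ :* k′) := lit 2 :* (κ :* e))
             refl (fromℕ k′) e κ ⟩
      fromℕ 2 * (κ * e) ∎)

    module _ (j : ℕ) (few : ¬ 1# ≤ fromℕ j * θ) where
      J : Carrier
      J = fromℕ j

      2J≤H : fromℕ 2 * J ≤ H
      2J≤H = certificate
        (proj₁ 0<H ⊗ (difference (≰⇒≥ few) ⊕ 0≤fromℕ j ⊗ (0≤fromℕ 2 ⊗ 0≤κ))) (begin
        H - fromℕ 2 * J
          ≡⟨ solve 2 (λ H J → H :- lit 2 :* J := H :- lit 2 :* J :* lit 1) refl H J ⟩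
        H - fromℕ 2 * J * 1#
          ≡⟨ cong (λ o → H - fromℕ 2 * J * o) (sym (inverseʳ 0<H)) ⟩
        H - fromℕ 2 * J * (H * h)
          ≡⟨ solve 4 (λ H h J κ → H :- lit 2 :* J :* (H :* h) :=
               H :* (lit 1 :- J :* (lit 2 :* h :+ lit 2 :* κ) :+ J :* (lit 2 :* κ))) refl H h J κ ⟩
        H * (1# - J * θ + J * (fromℕ 2 * κ)) ∎)

      2J≤K : fromℕ 2 * J ≤ K
      2J≤K = certificate
        (proj₁ 0<K ⊗ (difference (≰⇒≥ few) ⊕ 0≤fromℕ j ⊗ (0≤fromℕ 2 ⊗ 0≤h))) (begin
        K - fromℕ 2 * J
          ≡⟨ solve 2 (λ K J → K :- lit 2 :* J := K :- lit 2 :* J :* lit 1) refl K J ⟩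
        K - fromℕ 2 * J * 1#
          ≡⟨ cong (λ o → K - fromℕ 2 * J * o) (sym (inverseʳ 0<K)) ⟩
        K - fromℕ 2 * J * (K * κ)
          ≡⟨ solve 4 (λ K h J κ → K :- lit 2 :* J :* (K :* κ) :=
               K :* (lit 1 :- J :* (lit 2 :* h :+ lit 2 :* κ) :+ J :* (lit 2 :* h))) refl K h J κ ⟩
        K * (1# - J * θ + J * (fromℕ 2 * h)) ∎)

      -- The calibration of `H`: it turns a loss of order ε² H / K into one of order 1 / H.
      hK≡ε²H : h * K ≡ ε * ε * H
      hK≡ε²H = begin
        h * K                       ≡⟨ cong (h *_) K≡ ⟩
        h * (R * R)                 ≡⟨ cong (λ R → h * (R * R)) (sym εH≡R) ⟩
        h * (ε * H * (ε * H))       ≡⟨ solve 3 (λ h ε H → h :* (ε :* H :* (ε :* H)) :=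
                                          ε :* ε :* H :* (H :* h)) refl h ε H ⟩
        ε * ε * H * (H * h)         ≡⟨ cong (ε * ε * H *_) (inverseʳ 0<H) ⟩
        ε * ε * H * 1#              ≡⟨ *-identityʳ _ ⟩
        ε * ε * H                   ∎

      gap : e * e * (H + J) ≤ s * (W - (H + J)) * (W′ * W′)
      -- Both sides meet at 216 G² ε² H W′². The left is at most 9 ε² W² (3/2) H, with W² ≤ 16 G²
      -- W′²; the right is at least 432 G² (K / 2) W′² / H, with K / H = ε² H. The cancelled factor
      -- 2 clears the halves.
      gap = *-cancelˡ (0<fromℕ 1) (certificate
        ( (0≤fromℕ 432 ⊗ (⁻¹-nonneg 0<g ⊗ ⁻¹-nonneg 0<g)) ⊗ (0≤h ⊗ (difference 2J≤K ⊗ square-nonneg W′))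
        ⊕ 0≤fromℕ 27 ⊗ ((0≤ε ⊗ 0≤ε) ⊗ (proj₁ 0<H ⊗ difference W²≤))
        ⊕ 0≤fromℕ 3 ⊗ (proj₁ 0<H ⊗ difference (square-mono (0≤fromℕ (suc d)) e≤3εW))
        ⊕ square-nonneg e ⊗ difference 2J≤H)
        (begin
        fromℕ 2 * (s * (W - (H + J)) * (W′ * W′)) - fromℕ 2 * (e * e * (H + J))
          ≡⟨ solve 7 (λ Q h H K J Q′ E →
               lit 2 :* (lit 432 :* Q :* h :* (H :+ K :- (H :+ J)) :* Q′) :- lit 2 :* (E :* (H :+ J)) :=
               lit 432 :* Q :* (h :* ((K :- lit 2 :* J) :* Q′)) :+ lit 432 :* Q :* Q′ :* (h :* K)
                 :- lit 2 :* (E :* (H :+ J)))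
               refl (G * G) h H K J (W′ * W′) (e * e) ⟩
        fromℕ 432 * (G * G) * (h * ((K - fromℕ 2 * J) * (W′ * W′)))
          + fromℕ 432 * (G * G) * (W′ * W′) * (h * K) - fromℕ 2 * (e * e * (H + J))
          ≡⟨ cong (λ z → fromℕ 432 * (G * G) * (h * ((K - fromℕ 2 * J) * (W′ * W′)))
               + fromℕ 432 * (G * G) * (W′ * W′) * z - fromℕ 2 * (e * e * (H + J))) hK≡ε²H ⟩
        fromℕ 432 * (G * G) * (h * ((K - fromℕ 2 * J) * (W′ * W′)))
          + fromℕ 432 * (G * G) * (W′ * W′) * (ε * ε * H) - fromℕ 2 * (e * e * (H + J))
          ≡⟨ solve 8 (λ A Q Q′ ε H J E W →
               A :+ lit 432 :* Q :* Q′ :* (ε :* ε :* H) :- lit 2 :* (E :* (H :+ J)) :=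
               A :+ lit 27 :* (ε :* ε :* (H :* (lit 16 :* Q :* Q′ :- W :* W)))
                 :+ lit 3 :* (H :* (lit 3 :* (ε :* W) :* (lit 3 :* (ε :* W)) :- E))
                 :+ E :* (H :- lit 2 :* J))
               refl (fromℕ 432 * (G * G) * (h * ((K - fromℕ 2 * J) * (W′ * W′))))
               (G * G) (W′ * W′) ε H J (e * e) W ⟩
        fromℕ 432 * (G * G) * (h * ((K - fromℕ 2 * J) * (W′ * W′)))
          + fromℕ 27 * (ε * ε * (H * (fromℕ 16 * (G * G) * (W′ * W′) - W * W)))
          + fromℕ 3 * (H * (fromℕ 3 * (ε * W) * (fromℕ 3 * (ε * W)) - e * e))
          + e * e * (H - fromℕ 2 * J) ∎))

    parameters : Parameters
    parameters = record
      { W = W ; W′ = W′ ; H = H ; θ = θ ; τ = τ ; s = s ; k′ = k′ ; d = d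
      ; 0<W = 0<W ; 0<W′ = 0<W′ ; W≡ = W′+e≡W ; W′≡ = refl
      ; 0≤θ = 0≤fromℕ 2 ⊗ 0≤h ⊕ 0≤fromℕ 2 ⊗ 0≤κ
      ; 0≤τ = 0≤fromℕ 2 ⊗ 0≤h
      ; 0≤s = 0≤fromℕ 432 ⊗ (⁻¹-nonneg 0<g ⊗ ⁻¹-nonneg 0<g) ⊗ 0≤h
      ; drift = drift ; gap = gap
      }

    -- Since ε H = R, the quantity m / H is m ε / R. The heavy item makes n = R² + 1, which 1 ≤ R
    -- bounds by (2 R)², so the root is the rational expression 2 δ R.
    mh≤2δ : ∀ {m δ} → 0# ≤ δ →
            (fromℕ m * ε) * (fromℕ m * ε) ≤ (δ * δ) * fromℕ (suc k) → fromℕ m * h ≤ fromℕ 2 * δ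
    mh≤2δ {m} {δ} 0≤δ p = *-cancelˡ 0<R (subst₂ _≤_ eq (*-comm (fromℕ 2 * δ) R) mε≤2δR)
      where
      mε≤2δR : fromℕ m * ε ≤ fromℕ 2 * δ * R
      mε≤2δR = square-cancel-≤ (0≤fromℕ 2 ⊗ 0≤δ ⊗ proj₁ 0<R) (≤-trans p (certificate
        ((0≤δ ⊗ 0≤δ) ⊗ (0≤fromℕ 2 ⊗ (proj₁ 0<R ⊗ proj₁ 0<R) ⊕ difference (square-mono 0≤1 1≤R)))
        (begin
        fromℕ 2 * δ * R * (fromℕ 2 * δ * R) - δ * δ * (1# + K)
          ≡⟨ cong (λ K → fromℕ 2 * δ * R * (fromℕ 2 * δ * R) - δ * δ * (1# + K)) K≡ ⟩
        fromℕ 2 * δ * R * (fromℕ 2 * δ * R) - δ * δ * (1# + R * R)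
          ≡⟨ solve 2 (λ δ R →
               lit 2 :* δ :* R :* (lit 2 :* δ :* R) :- δ :* δ :* (lit 1 :+ R :* R) :=
               δ :* δ :* (lit 2 :* (R :* R) :+ (R :* R :- lit 1 :* lit 1))) refl δ R ⟩
        δ * δ * (fromℕ 2 * (R * R) + (R * R - 1# * 1#)) ∎)))

      eq : fromℕ m * ε ≡ R * (fromℕ m * h)
      eq = begin
        fromℕ m * ε              ≡⟨ solve 2 (λ m ε → m :* ε := m :* ε :* lit 1) refl (fromℕ m) ε ⟩
        fromℕ m * ε * 1#         ≡⟨ cong (fromℕ m * ε *_) (sym (inverseʳ 0<H)) ⟩
        fromℕ m * ε * (H * h)    ≡⟨ solve 4 (λ m ε H h → m :* ε :* (H :* h) := ε :* H :* (m :* h))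
                                      refl (fromℕ m) ε H h ⟩
        ε * H * (fromℕ m * h)    ≡⟨ cong (_* (fromℕ m * h)) εH≡R ⟩
        R * (fromℕ m * h)        ∎

    no-algorithm : ∀ {q δ m} → fromℕ 3 * q ≡ fromℕ 2 → 0# ≤ δ → fromℕ 60 * δ ≤ 1# →
      fromℕ 13824 * δ ≤ g * g →
      (fromℕ m * ε) * (fromℕ m * ε) ≤ (δ * δ) * fromℕ (suc k) →
      (A : Algorithm m) →
      ¬ (∀ (I : Instance (suc k)) → q ≤ Pr[ A on I outputs isApproximation? ε (Instance.W I) ])
    no-algorithm {q} {δ} {m} 3q≡2 0≤δ 60δ≤1 13824δ≤g² m-small A correct =
      incompatible m 3q≡2 (Parameters.0≤s parameters)
        (subst (q ≤_) (Pr-hard 0<H k′≤k A ε) (correct (hard 0<H k′≤k)))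
        (subst (q ≤_) (Pr-hard 0<H ℕ.≤-refl A ε) (correct (hard 0<H ℕ.≤-refl)))
        (canonical-disjoint 0<W
          (payoff-disjoint approx′? approx? λ x (_ , x≤) (≤x , _) → separated (≤-trans ≤x x≤))
          [] A 0≤v k V+k≡)
        (Close.x≤ closeness)
        (canonical-nonneg 0<W (payoff-nonneg approx′?) [] A 0≤v k V+k≡)
        (Close.b²≤ closeness)
        -- At the start no light item has been seen, so the truncation error is m τ = 2 m h, and 15
        -- of these are at most 60 δ.
        (certificate (0≤fromℕ 30 ⊗ difference mh≤ ⊕ difference 60δ≤1)
          (solve 4 (λ m h δ θ → lit 1 :- lit 15 :* (lit 0 :* θ :+ m :* (lit 2 :* h)) :=
              lit 30 :* (lit 2 :* δ :- m :* h) :+ (lit 1 :- lit 60 :* δ)) refl (fromℕ m) h δ θ))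
        (certificate
          ( 0≤fromℕ 6912 ⊗ ((0≤G ⊗ 0≤G) ⊗ difference mh≤)
          ⊕ (0≤G ⊗ 0≤G) ⊗ difference 13824δ≤g²)
          (begin
          1# - fromℕ 16 * (fromℕ m * s)
            ≡⟨ solve 1 (λ x → lit 1 :- x := lit 1 :* lit 1 :- x) refl (fromℕ 16 * (fromℕ m * s)) ⟩
          1# * 1# - fromℕ 16 * (fromℕ m * s)
            ≡⟨ cong (λ o → o * o - fromℕ 16 * (fromℕ m * s)) (sym (inverseʳ 0<g)) ⟩
          g * G * (g * G) - fromℕ 16 * (fromℕ m * s)
            ≡⟨ solve 5 (λ g G m h δ →
                 g :* G :* (g :* G) :- lit 16 :* (m :* (lit 432 :* (G :* G) :* h)) :=
                 lit 6912 :* (G :* G :* (lit 2 :* δ :- m :* h)) :+ G :* G :* (g :* g :- lit 13824 :* δ))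
                 refl g G (fromℕ m) h δ ⟩
          fromℕ 6912 * (G * G * (fromℕ 2 * δ - fromℕ m * h)) + G * G * (g * g - fromℕ 13824 * δ) ∎))
      where
      approx?  = isApproximation? ε W
      approx′? = isApproximation? ε W′

      0≤G : 0# ≤ G
      0≤G = ⁻¹-nonneg 0<g

      mh≤ : fromℕ m * h ≤ fromℕ 2 * δ
      mh≤ = mh≤2δ {m} 0≤δ m-small

      0≤v : ∀ (i : Fin 1) → 0# ≤ H
      0≤v _ = proj₁ 0<H

      V+k≡ : (H + 0#) + fromℕ k ≡ W
      V+k≡ = cong (_+ K) (+-identityʳ H)

      closeness = canonical-close parameters (payoff-nonneg approx′?) (payoff-≤1 approx′?)
        {v = λ (_ : Fin 1) → H} [] A 0≤v 0 k′ refl (cong (_+ fromℕ k′) (+-identityʳ H))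

-- From the asymptotic hypothesis to a single n

theorem17 : ∀ {c ℓ} (F : ArchimedeanOrderedField c ℓ) →
    let open ArchimedeanOrderedField F
        open ProportionalSetting F
        open Instance using (W)
    in
    (ε : ℕ → Carrier) (ε₀ : Carrier) →
    (∀ n → 0# < ε n) → (∀ n → ε n ≤ ε₀) → ε₀ < 1# →
    (m : ℕ → ℕ) → m =o[√n/ ε ] →
    ¬ (Σ[ A ∈ (∀ n → Algorithm (m n)) ]
         (∀ n (I : Instance n) →
            fromℕ 2 / fromℕ 3 ≤ Pr[ A n on I outputs isApproximation? (ε n) (W I) ]))
theorem17 F ε ε₀ 0<ε ε≤ε₀ ε₀<1 m m-small (A , correct) =
  Gap.no-algorithm (0<ε n) 0<g g≤1-ε r 1≤R 4≤gR {m = m n} 3q≡2 (proj₁ 0<δ) 60δ≤1 13824δ≤g²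
    (proj₂ (m-small δ 0<δ) n N≤n) (A n) (correct n)
  where
  open ArchimedeanOrderedField F
  open FieldProperties F
  open LowerBound F using (module Gap)
  open Solver using (solve; _:=_; _:+_; _:*_; _:-_)
  open ≡-Reasoning

  -- 13824 = 16 · 432 · 2 makes 16 m s ≤ 1.
  g c₀ δ : Carrier
  g  = 1# - ε₀
  c₀ = fromℕ 13824
  δ  = g * g * c₀ ⁻¹

  0<g : 0# < g
  0<g = ≰⇒> λ g≤0 → <⇒≱ ε₀<1 (certificate (difference g≤0)
    (solve 1 (λ e → e :- lit 1 := lit 0 :- (lit 1 :- e)) refl ε₀))

  0<c₀ : 0# < c₀
  0<c₀ = 0<fromℕ 13823

  0<δ : 0# < δ
  0<δ = *-pos (*-pos 0<g 0<g) (⁻¹-pos 0<c₀)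

  N r r′ n : ℕ
  N  = proj₁ (m-small δ 0<δ)
  -- `r′` secures 4 ≤ g R, adding `N` puts n beyond the threshold of the o-hypothesis, and the
  -- successor gives 1 ≤ R. One item of n is the heavy one.
  r′ = proj₁ (archimedean (fromℕ 4 * g ⁻¹))
  r  = suc (r′ ℕ.+ N)
  n  = suc (r ℕ.* r)

  N≤n : N ℕ.≤ n
  N≤n = ℕ.≤-trans (ℕ.m≤n+m N r′) (ℕ.≤-trans (ℕ.n≤1+n _) (ℕ.≤-trans (ℕ.m≤m*n r r) (ℕ.n≤1+n _)))

  1≤R : 1# ≤ fromℕ r
  1≤R = certificate (0≤fromℕ (r′ ℕ.+ N)) (solve 1 (λ x → lit 1 :+ x :- lit 1 := x) refl (fromℕ (r′ ℕ.+ N)))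

  4≤gR : fromℕ 4 ≤ g * fromℕ r
  4≤gR = subst (_≤ g * fromℕ r) (begin
      g * (fromℕ 4 * g ⁻¹)   ≡⟨ solve 2 (λ g i → g :* (lit 4 :* i) := lit 4 :* (g :* i)) refl g (g ⁻¹) ⟩
      fromℕ 4 * (g * g ⁻¹)   ≡⟨ cong (fromℕ 4 *_) (inverseʳ 0<g) ⟩
      fromℕ 4 * 1#           ≡⟨ *-identityʳ _ ⟩
      fromℕ 4                ∎)
    (*-monoˡ (proj₁ 0<g) (≤-trans (proj₂ (archimedean (fromℕ 4 * g ⁻¹)))
      (fromℕ-mono (ℕ.≤-trans (ℕ.m≤m+n r′ N) (ℕ.n≤1+n _)))))

  g≤1-ε : g ≤ 1# - ε n
  g≤1-ε = certificate (difference (ε≤ε₀ n))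
    (solve 2 (λ e e₀ → lit 1 :- e :- (lit 1 :- e₀) := e₀ :- e) refl (ε n) ε₀)

  3q≡2 : fromℕ 3 * (fromℕ 2 / fromℕ 3) ≡ fromℕ 2
  3q≡2 = begin
    fromℕ 3 * (fromℕ 2 * fromℕ 3 ⁻¹)   ≡⟨ solve 1 (λ i → lit 3 :* (lit 2 :* i) := lit 2 :* (lit 3 :* i))
                                             refl (fromℕ 3 ⁻¹) ⟩
    fromℕ 2 * (fromℕ 3 * fromℕ 3 ⁻¹)   ≡⟨ cong (fromℕ 2 *_) (inverseʳ (0<fromℕ 2)) ⟩
    fromℕ 2 * 1#                       ≡⟨ *-identityʳ _ ⟩
    fromℕ 2                            ∎

  c₀δ≡g² : c₀ * δ ≡ g * g
  c₀δ≡g² = begin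
    c₀ * (g * g * c₀ ⁻¹)   ≡⟨ solve 3 (λ c g i → c :* (g :* g :* i) := g :* g :* (c :* i)) refl c₀ g (c₀ ⁻¹) ⟩
    g * g * (c₀ * c₀ ⁻¹)   ≡⟨ cong (g * g *_) (inverseʳ 0<c₀) ⟩
    g * g * 1#             ≡⟨ *-identityʳ _ ⟩
    g * g                  ∎

  13824δ≤g² : fromℕ 13824 * δ ≤ g * g
  13824δ≤g² = ≤-reflexive c₀δ≡g²

  -- Much room is left: 60 δ ≤ 13824 δ = g² ≤ 1.
  60δ≤1 : fromℕ 60 * δ ≤ 1#
  60δ≤1 = certificate
    ( 0≤fromℕ 13764 ⊗ proj₁ 0<δ
    ⊕ (difference g≤1 ⊗ (0≤1 ⊕ proj₁ 0<g)))
    (begin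
    1# - fromℕ 60 * δ
      ≡⟨ solve 2 (λ g δ → lit 1 :- lit 60 :* δ :=
           lit 1 :- lit 60 :* δ :+ g :* g :- g :* g) refl g δ ⟩
    1# - fromℕ 60 * δ + g * g - g * g
      ≡⟨ cong (λ x → 1# - fromℕ 60 * δ + x - g * g) (sym c₀δ≡g²) ⟩
    1# - fromℕ 60 * δ + fromℕ 13824 * δ - g * g
      ≡⟨ solve 2 (λ g δ → lit 1 :- lit 60 :* δ :+ lit 13824 :* δ :- g :* g :=
           lit 13764 :* δ :+ (lit 1 :- g) :* (lit 1 :+ g)) refl g δ ⟩
    fromℕ 13764 * δ + (1# - g) * (1# + g) ∎)
    where
    g≤1 : g ≤ 1#
    g≤1 = certificate (≤-trans (proj₁ (0<ε 0)) (ε≤ε₀ 0))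
      (solve 1 (λ e → lit 1 :- (lit 1 :- e) := e) refl ε₀)
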